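{- Let $G$ be a finite connected graph and $r \geq 4$ an integer. Then $G$ is $r$-locally interval if and only if $G$ is $r$-acyclic circular-arc.
   Context: A graph $G$ is an interval graph if there is a path $P$ and a mapping $v \mapsto P_v$ from vertices $v$ of $G$ to subpaths $P_v$ of $P$ such that $uv$ is an edge of $G$ if and only if $P_u$ and $P_v$ share at least one vertex. For a vertex $v$ of $G$ and integer $r \geq 0$, the ball $B_G(v, r/2)$ is the subgraph of $G$ whose vertex set consists of the vertices at distance at most $\lfloor r/2 \rfloor$ from $v$ and whose edge set consists of the edges $xy$ of $G$ with $d(v,x) + d(v,y) < r$. A graph $G$ is $r$-locally interval if every ball $B_G(v, r/2)$ is an interval graph. A graph $G$ is circular-arc if there is a cycle $C$ and a mapping $v \mapsto C_v$ from vertices of $G$ to subpaths $C_v$ of $C$ such that $uv$ is an edge of $G$ if and only if $C_u$ and $C_v$ share at least one vertex (a circular-arc representation). Such a representation is $r$-acyclic if for every set $X \subseteq V(G)$ with $|X| \leq r$, the subgraph $\bigcup_{x \in X} C_x$ of $C$ is acyclic; $G$ is $r$-acyclic circular-arc if it has an $r$-acyclic circular-arc representation. -}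

module Defs where

open import Data.Nat using (ℕ; zero; suc; _+_; _∸_; _≤_; _<_; _%_; _/_)
open import Data.Fin using (Fin; toℕ)
open import Data.Fin.Subset using (Subset; _∈_; ∣_∣)
open import Data.Bool using (Bool; true; false)
open import Data.Product using (Σ; ∃; ∃-syntax; _×_; _,_)
open import Relation.Binary.PropositionalEquality using (_≡_; _≢_)
open import Relation.Nullary using (¬_)
open import Function.Bundles using (_⇔_)

record Graph (n : ℕ) : Set where
  field
    adj   : Fin n → Fin n → Bool
    sym   : ∀ x y → adj x y ≡ adj y x
    irrefl : ∀ x → adj x x ≡ false

open Graph public

Edge : ∀ {n} → Graph n → Fin n → Fin n → Set
Edge G x y = adj G x y ≡ true

data Walk {n : ℕ} (G : Graph n) : Fin n → Fin n → ℕ → Set where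
  here : ∀ {x} → Walk G x x zero
  step : ∀ {x y z k} → Edge G x y → Walk G y z k → Walk G x z (suc k)

Connected : ∀ {n} → Graph n → Set
Connected G = ∀ x y → ∃[ k ] Walk G x y k

Dist : ∀ {n} → Graph n → Fin n → Fin n → ℕ → Set
Dist G x y k = Walk G x y k × (∀ l → Walk G x y l → k ≤ l)

BallVertex : ∀ {n} → Graph n → Fin n → ℕ → Fin n → Set
BallVertex G v r x = ∃[ k ] (Dist G v x k × k ≤ r / 2)

BallEdge : ∀ {n} → Graph n → Fin n → ℕ → Fin n → Fin n → Set
BallEdge G v r x y =
  Edge G x y × ∃[ a ] ∃[ b ] (Dist G v x a × Dist G v y b × a + b < r)

-- Interval graphs.
-- A (sub)graph given by a vertex predicate V ⊆ Fin n and edge relation E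
-- is an interval graph if there is a path P = 0 - 1 - ... - (m-1) and,
-- for each vertex x ∈ V, a (nonempty) subpath [lo x , hi x] of P such
-- that distinct x, y ∈ V are adjacent iff their subpaths share a vertex.

record IntervalRep {n : ℕ} (V : Fin n → Set) (E : Fin n → Fin n → Set) : Set where
  field
    m      : ℕ
    lo hi  : Fin n → ℕ
    valid  : ∀ x → V x → lo x ≤ hi x × hi x < m
    repr   : ∀ x y → V x → V y → x ≢ y →
             (E x y ⇔ (lo x ≤ hi y × lo y ≤ hi x))

IsInterval : ∀ {n} → (Fin n → Set) → (Fin n → Fin n → Set) → Set
IsInterval V E = IntervalRep V E

LocallyInterval : ∀ {n} → ℕ → Graph n → Set
LocallyInterval r G = ∀ v → IsInterval (BallVertex G v r) (BallEdge G v r)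

-- Circular-arc representations.
-- The cycle C has vertices Fin (3 + k) with edges j — (j+1 mod (3+k));
-- edge number j is the edge between j and j+1 mod (3+k).
-- A subpath of C is given by a start vertex s and a number of edges
-- ℓ ≤ |C| - 1: its vertices are s, s+1, ..., s+ℓ and its edges are the
-- edges numbered s, s+1, ..., s+ℓ-1 (all mod |C|).

offset : (k : ℕ) → Fin (3 + k) → Fin (3 + k) → ℕ
offset k s j = (toℕ j + ((3 + k) ∸ toℕ s)) % (3 + k)

record CARep {n : ℕ} (G : Graph n) : Set where
  field
    k      : ℕ
    start  : Fin n → Fin (3 + k)
    len    : Fin n → ℕ               -- number of edges of the subpath C_x
    len<   : ∀ x → len x < 3 + k      -- a path in C has at most |C| - 1 edges

  ArcVertex : Fin n → Fin (3 + k) → Set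
  ArcVertex x j = offset k (start x) j ≤ len x

  ArcEdge : Fin n → Fin (3 + k) → Set
  ArcEdge x j = offset k (start x) j < len x

  field
    repr : ∀ x y → x ≢ y → (Edge G x y ⇔ (∃[ j ] (ArcVertex x j × ArcVertex y j)))

  -- The subgraph ⋃_{x ∈ X} C_x of the cycle C is acyclic.  The only
  -- cycle contained in C is C itself, so this means that some edge of C
  -- is not covered by any C_x with x ∈ X.
  UnionAcyclic : Subset n → Set
  UnionAcyclic X = ∃[ j ] (∀ x → x ∈ X → ¬ ArcEdge x j)

open CARep public

Acyclic : ∀ {n} {G : Graph n} → ℕ → CARep G → Set
Acyclic {n} r R = ∀ (X : Subset n) → ∣ X ∣ ≤ r → UnionAcyclic R X

AcyclicCircularArc : ∀ {n} → ℕ → Graph n → Set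
AcyclicCircularArc r G = Σ (CARep G) (λ R → Acyclic r R)

{-# OPTIONS --safe #-}
module Submission where

-- Forward direction.  Let o be a vertex of maximum degree and N its closed
-- neighbourhood.  An interval representation of the ball around o tells for each
-- edge between N and the rest whether it leaves N on the left or on the right;
-- counting the crossings on the left gives an integer cocycle w that vanishes on
-- triangles, hence, balls being interval graphs, on all closed walks of length
-- at most r.  In the cyclic cover defined by w one sweeps to the right, starting
-- from a maximal clique at the right end of o and passing from one clique to the
-- next through a neighbour that reaches furthest; each step is read off a ball.
-- Either the sweep returns to N, and what it has listed together with N makes up
-- the circle, or it stops, and so does the sweep to the left.  A set of at most r
-- arcs that covers the circle contains a closed walk with w-sum 1.
--
-- Backward direction.  Arcs are unrolled along shortest walks from the centre
-- of a ball.  The at most r arcs on two such walks miss an edge of the cycle, and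
-- cutting there shows that the unrolled positions of the two ends agree.

open import Defs hiding (sym; k; repr; start; len; len<)
open import Data.Bool using (Bool; true; false)
import Data.Bool.Properties as Bool
open import Data.Empty using (⊥; ⊥-elim)
open import Data.Fin using (Fin; toℕ; fromℕ<)
import Data.Fin as Fin
import Data.Fin.Properties as Fin
open import Data.Fin.Subset using (Subset; ∣_∣; ⁅_⁆; _∪_) renaming (_∈_ to _∈ₛ_; ⊥ to ∅)
import Data.Fin.Subset.Properties as Subset
open import Data.Integer using (ℤ; 0ℤ; 1ℤ; -1ℤ) renaming (_+_ to _⊕_; _-_ to _⊖_)
import Data.Integer.Properties as ℤ
import Data.Integer.Tactic.RingSolver as ℤ-Solver
open import Algebra.Properties.AbelianGroup ℤ.+-0-abelianGroup using (identityʳ-unique; ∙-cancelʳ)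
open import Data.List using (List; []; _∷_; _++_; length; map; allFin; cartesianProduct)
open import Data.List.Properties using (length-map; length-++)
open import Data.List.Membership.Propositional using (_∈_; find; lose)
open import Data.List.Membership.Propositional.Properties
  using (∈-allFin; ∈-cartesianProduct⁺; ∈-map⁺; ∈-++⁺ˡ; ∈-++⁺ʳ)
open import Data.List.Relation.Unary.Any using (here; there; any?)
open import Data.Nat using (ℕ; zero; suc; _+_; _*_; _/_; _%_; _∸_; _≤_; _<_; z≤n; s≤s; _⊓_; _≤?_; _<?_)
open import Data.Nat.DivMod using (/-monoˡ-≤; m*n/n≡m; m/n*n≤m; [m+n]%n≡m%n; m<n⇒m%n≡m)
open import Data.Nat.Properties
import Data.Nat.Tactic.RingSolver as ℕ-Solver
open import Data.Product using (∃; ∃-syntax; _×_; _,_; proj₁; proj₂; swap)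
open import Data.Sum using (_⊎_; inj₁; inj₂; [_,_]′)
open import Data.Unit using (⊤; tt)
open import Data.Vec using ([]; _∷_)
import Data.Vec as Vec
open import Function.Bundles using (_⇔_; Equivalence; mk⇔)
open import Relation.Binary.PropositionalEquality
open import Relation.Nullary using (¬_; Dec; yes; no; contradiction)
open import Relation.Nullary.Decidable using (_×-dec_; _⊎-dec_; ¬?; map′)

-- Finite search

-- The choice of `o` is what makes left and right well defined. A vertex of `N` with outside
-- neighbours on both sides would span the interval of `o`, hence be adjacent to all of `N` and to
-- an outside vertex besides, and its degree would exceed that of `o`. The same count shows that a
-- vertex of `N` attached on one side misses the neighbour of `o` lying furthest towards the other
-- side; this starts the sweep and later decides the order of intervals. The main obstacle of the
-- sweep is that interval representations of different balls have unrelated directions. Each clique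
-- therefore carries a pair of anchors on the side already swept, and the next ball is mirrored if
-- necessary. The constant 4 serves twice: a ball then sees every edge with an end next to its
-- centre, and closed walks of length four have sum zero, so local pictures lift to the cover. The
-- general `r` matters only when arcs around the circle are counted: a closed walk using each of at
-- most `r` arcs once has length at most `r`, which is exactly the range in which sums vanish.

count : ∀ {A : Set} {P : A → Set} → (∀ x → Dec (P x)) → List A → ℕ
count P? [] = 0
count P? (x ∷ xs) with P? x
... | yes _ = suc (count P? xs)
... | no _ = count P? xs

module _ {A : Set} {P Q : A → Set} (P? : ∀ x → Dec (P x)) (Q? : ∀ x → Dec (Q x))
         (P⊆Q : ∀ x → P x → Q x) where

  count-mono-≤ : ∀ xs → count P? xs ≤ count Q? xs
  count-mono-≤ [] = z≤n
  count-mono-≤ (x ∷ xs) with P? x | Q? x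
  ... | yes _ | yes _ = s≤s (count-mono-≤ xs)
  ... | yes p | no ¬q = contradiction (P⊆Q x p) ¬q
  ... | no _ | yes _ = m≤n⇒m≤1+n (count-mono-≤ xs)
  ... | no _ | no _ = count-mono-≤ xs

  count-mono-< : ∀ {xs x} → x ∈ xs → Q x → ¬ P x → count P? xs < count Q? xs
  count-mono-< {y ∷ xs} (here refl) q ¬p with P? y | Q? y
  ... | yes p | _ = contradiction p ¬p
  ... | no _ | yes _ = s≤s (count-mono-≤ xs)
  ... | no _ | no ¬q = contradiction q ¬q
  count-mono-< {y ∷ xs} (there x∈) q ¬p with P? y | Q? y
  ... | yes _ | yes _ = s≤s (count-mono-< x∈ q ¬p)
  ... | yes p | no ¬q = contradiction (P⊆Q y p) ¬q
  ... | no _ | yes _ = m≤n⇒m≤1+n (count-mono-< x∈ q ¬p)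
  ... | no _ | no _ = count-mono-< x∈ q ¬p

count-pos : ∀ {A : Set} {P : A → Set} (P? : ∀ x → Dec (P x)) {xs x} →
            x ∈ xs → P x → 0 < count P? xs
count-pos P? {y ∷ xs} (here refl) p with P? y
... | yes _ = s≤s z≤n
... | no ¬p = contradiction p ¬p
count-pos P? {y ∷ xs} (there x∈) p with P? y
... | yes _ = s≤s z≤n
... | no _ = count-pos P? x∈ p

count-witness : ∀ {A : Set} {P : A → Set} (P? : ∀ x → Dec (P x)) xs → 0 < count P? xs → ∃ P
count-witness P? (x ∷ xs) c with P? x
... | yes p = x , p
... | no _ = count-witness P? xs c

module _ {A : Set} (_≼_ : A → A → Set)
         (≼-trans : ∀ {x y z} → x ≼ y → y ≼ z → x ≼ z)
         (≼-total : ∀ x y → x ≼ y ⊎ y ≼ x)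
         {P : A → Set} (P? : ∀ x → Dec (P x)) where

  ≼-refl : ∀ {x} → x ≼ x
  ≼-refl {x} = [ (λ p → p) , (λ p → p) ]′ (≼-total x x)

  greatest? : ∀ xs → (∀ {x} → x ∈ xs → ¬ P x) ⊎
              (∃[ m ] (P m × (∀ {x} → x ∈ xs → P x → x ≼ m)))
  greatest? [] = inj₁ λ ()
  greatest? (x ∷ xs) with P? x | greatest? xs
  ... | no ¬p | inj₁ none = inj₁ λ { (here refl) → ¬p ; (there i) → none i }
  ... | no ¬p | inj₂ (m , pm , max) =
    inj₂ (m , pm , λ { (here refl) p → contradiction p ¬p ; (there i) → max i })
  ... | yes p | inj₁ none =
    inj₂ (x , p , λ { (here refl) _ → ≼-refl ; (there i) q → contradiction q (none i) })
  ... | yes p | inj₂ (m , pm , max) with ≼-total x m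
  ...   | inj₁ x≼m = inj₂ (m , pm , λ { (here refl) _ → x≼m ; (there i) → max i })
  ...   | inj₂ m≼x = inj₂ (x , p , λ { (here refl) _ → ≼-refl ; (there i) q → ≼-trans (max i q) m≼x })

record Finite (A : Set) : Set where
  field
    elems    : List A
    complete : ∀ x → x ∈ elems

module FiniteSearch {A : Set} (fin : Finite A) where
  open Finite fin public

  ∃? : ∀ {P : A → Set} → (∀ x → Dec (P x)) → Dec (∃ P)
  ∃? P? = map′ (λ i → let x , _ , p = find i in x , p) (λ (x , p) → lose (complete x) p) (any? P? elems)

  module _ {P : A → Set} (P? : ∀ x → Dec (P x)) (f : A → ℕ) where

    argmax : ∃ P → ∃[ m ] (P m × (∀ x → P x → f x ≤ f m))
    argmax (x , p) with greatest? (λ x y → f x ≤ f y) ≤-trans (λ x y → ≤-total (f x) (f y)) P? elems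
    ... | inj₁ none = contradiction p (none (complete x))
    ... | inj₂ (m , pm , max) = m , pm , λ y → max (complete y)

    argmin : ∃ P → ∃[ m ] (P m × (∀ x → P x → f m ≤ f x))
    argmin (x , p) with greatest? (λ x y → f y ≤ f x) (λ p q → ≤-trans q p) (λ x y → ≤-total (f y) (f x)) P? elems
    ... | inj₁ none = contradiction p (none (complete x))
    ... | inj₂ (m , pm , max) = m , pm , λ y → max (complete y)

-- Sweeping through a sequence of cliques

module Local {A : Set} (D : A → A → Set) where

  Near : A → A → Set
  Near h y = ∃[ x ] (D h x × D x y)

  -- Intervals for the vertices within distance two of h, faithful to D on all
  -- pairs at least one member of which is within distance one.
  record LocalRep (h : A) : Set where
    field
      lo hi : A → ℕ
      top   : ℕ
      valid : ∀ {y} → Near h y → lo y ≤ hi y × hi y ≤ top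
      touch : ∀ {x y} → D h x → Near h y → D x y → lo x ≤ hi y × lo y ≤ hi x
      meet  : ∀ {x y} → D h x → Near h y → lo x ≤ hi y → lo y ≤ hi x → D x y

    apart : ∀ {x y} → D h x → Near h y → ¬ D x y → hi x < lo y ⊎ hi y < lo x
    apart {x} {y} hx hy ¬d with lo x ≤? hi y | lo y ≤? hi x
    ... | yes p | yes q = contradiction (meet hx hy p q) ¬d
    ... | no p | _ = inj₂ (≰⇒> p)
    ... | yes _ | no q = inj₁ (≰⇒> q)

  open LocalRep

  module _ (D-refl : ∀ x → D x x) where

    D⇒Near : ∀ {h x} → D h x → Near h x
    D⇒Near {h} {x} d = x , d , D-refl x

    flip : ∀ {h} → LocalRep h → LocalRep h
    flip r .lo y = r .top ∸ r .hi y
    flip r .hi y = r .top ∸ r .lo y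
    flip r .top = r .top
    flip r .valid {y} n = ∸-monoʳ-≤ (r .top) (proj₁ (r .valid n)) , m∸n≤m (r .top) (r .lo y)
    flip r .touch hx hy d =
      ∸-monoʳ-≤ (r .top) (proj₂ (r .touch hx hy d)) , ∸-monoʳ-≤ (r .top) (proj₁ (r .touch hx hy d))
    flip r .meet hx hy p q =
      r .meet hx hy (∸-cancelʳ-≤ (lo≤top (D⇒Near hx)) q) (∸-cancelʳ-≤ (lo≤top hy) p)
      where
      lo≤top : ∀ {y} → Near _ y → r .lo y ≤ r .top
      lo≤top n = ≤-trans (proj₁ (r .valid n)) (proj₂ (r .valid n))

data Chain {A : Set} (D : A → A → Set) (K : A → Set) : A → Set where
  stop : ∀ {x} → K x → Chain D K x
  step : ∀ {x y} → D x y → Chain D K y → Chain D K x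

exit : ∀ {A : Set} {D : A → A → Set} {K B : A → Set} → (∀ x → Dec (B x)) →
       (∀ {x} → K x → ¬ B x) → ∀ {x} → B x → Chain D K x →
       ∃[ u ] ∃[ v ] (B u × ¬ B v × D u v)
exit B? K∩B bx (stop k) = contradiction bx (K∩B k)
exit B? K∩B {x} bx (step {y = y} d c) with B? y
... | yes by = exit B? K∩B by c
... | no ¬by = x , y , bx , ¬by , d

-- `S` may be smaller than `R`: by `S-closed` and `reach` it is the part of `R` that hangs on `K`.
-- Putting all of `K` at position 0 (`lo-K`) leaves one inequality to check for an overlap with `K`,
-- and allows the layout to be continued to the left.
record Swept {A : Set} (D : A → A → Set) (K R : A → Set) : Set₁ where
  field
    S        : A → Set
    S?       : ∀ x → Dec (S x)
    S⊆R      : ∀ {x} → S x → R x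
    S-closed : ∀ {x y} → S x → D x y → K y ⊎ S y
    K-S      : ∀ {x y} → K x → R y → D x y → S y
    reach    : ∀ {x} → S x → Chain D K x
    lo hi    : A → ℕ
    touch    : ∀ {x y} → K x ⊎ S x → K y ⊎ S y → D x y → lo x ≤ hi y
    meet     : ∀ {x y} → K x ⊎ S x → K y ⊎ S y → lo x ≤ hi y → lo y ≤ hi x → D x y
    lo-K     : ∀ {x} → K x → lo x ≡ 0

module Sweep {A : Set} (fin : Finite A) (D : A → A → Set) (D? : ∀ x y → Dec (D x y))
             (D-refl : ∀ x → D x x) (D-sym : ∀ {x y} → D x y → D y x)
             (rep : ∀ h → Local.LocalRep D h) where

  open FiniteSearch fin
  open Local D
  open LocalRep using (valid; touch; meet; apart)

  D⇒N : ∀ {h x} → D h x → Near h x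
  D⇒N = D⇒Near D-refl

  -- K is a maximal clique and R a part of the graph that is attached to the
  -- rest through K only.  The anchors g and ℓ fix the side of K on which R lies.
  record State (K R : A → Set) : Set where
    field
      K?      : ∀ x → Dec (K x)
      R?      : ∀ x → Dec (R x)
      clique  : ∀ {x y} → K x → K y → D x y
      maximal : ∀ {z} → (∀ {x} → K x → D x z) → K z
      R∩K     : ∀ {x} → R x → ¬ K x
      closed  : ∀ {x y} → R x → D x y → K y ⊎ R y
      g ℓ     : A
      g∈K     : K g
      g-R     : ∀ {x} → R x → ¬ D g x
      ℓ-g     : D ℓ g
      anchor  : ∀ {x r} → K x → R r → D x r → ¬ D x ℓ

  module Step {K R : A → Set} (st : State K R) where
    open State st

    nbrs? : ∀ x r → Dec (R r × D x r)
    nbrs? x r = R? r ×-dec D? x r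

    score : A → ℕ
    score x = count (nbrs? x) elems

    module Advance {h : A} (Kh : K h) (h-max : ∀ x → K x → score x ≤ score h)
                   {r₀ : A} (Rr₀ : R r₀) (h-r₀ : D h r₀)
                   (ρ : LocalRep h) (ℓ-left : LocalRep.hi ρ ℓ < LocalRep.lo ρ h) where
      open LocalRep ρ using (lo; hi)

      h∼ : ∀ {x} → K x → D h x
      h∼ k = clique Kh k

      h∼g : D h g
      h∼g = h∼ g∈K

      nearℓ : Near h ℓ
      nearℓ = g , h∼g , D-sym ℓ-g

      -- Helly on a line: the pairwise overlapping intervals of `K` share the last of their starting
      -- points, `p`.
      p-arg : ∃[ m ] (K m × (∀ x → K x → lo x ≤ lo m))
      p-arg = argmax K? lo (h , Kh)

      p : ℕ
      p = lo (proj₁ p-arg)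

      lo≤p : ∀ {x} → K x → lo x ≤ p
      lo≤p k = proj₂ (proj₂ p-arg) _ k

      p≤hi : ∀ {x} → K x → p ≤ hi x
      p≤hi k = let Km = proj₁ (proj₂ p-arg) in
        proj₁ (touch ρ (h∼ Km) (D⇒N (h∼ k)) (clique Km k))

      -- `q` is the last position at which a neighbour of `h` starts. The intervals of neighbours of
      -- `h` that contain `q` make up the next clique.
      q-arg : ∃[ m ] (D h m × (∀ x → D h x → lo x ≤ lo m))
      q-arg = argmax (D? h) lo (h , D-refl h)

      x* : A
      x* = proj₁ q-arg

      h∼x* : D h x*
      h∼x* = proj₁ (proj₂ q-arg)

      q : ℕ
      q = lo x*

      lo≤q : ∀ {x} → D h x → lo x ≤ q
      lo≤q d = proj₂ (proj₂ q-arg) _ d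

      q≤hi-h : q ≤ hi h
      q≤hi-h = proj₂ (touch ρ (D-refl h) (D⇒N h∼x*) h∼x*)

      lo-g≤hi-ℓ : lo g ≤ hi ℓ
      lo-g≤hi-ℓ = proj₁ (touch ρ h∼g nearℓ (D-sym ℓ-g))

      -- `g` overlaps `ℓ`, which ends before `h` starts. Whatever lies to the left of `g` thus ends
      -- before `h` starts and cannot be a neighbour of `h`.
      right-of-g : ∀ {r} → R r → D h r → hi g < lo r
      right-of-g {r} Rr d with apart ρ h∼g (D⇒N d) (g-R Rr)
      ... | inj₁ lt = lt
      ... | inj₂ lt = contradiction
        (<-≤-trans lt (≤-trans lo-g≤hi-ℓ (<⇒≤ ℓ-left)))
        (≤⇒≯ (proj₁ (touch ρ (D-refl h) (D⇒N d) d)))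

      right-of-K : ∀ {r} → R r → D h r → p < lo r
      right-of-K Rr d = ≤-<-trans (p≤hi g∈K) (right-of-g Rr d)

      -- Suppose `r` ended before `h` starts, and let `x` be the common neighbour. If `x` is in `R`,
      -- it starts after `p`, too late to meet `r`. If `x` is in `K`, it extends left to `r`, which
      -- lies left of `g`, and so it meets `ℓ`, against `anchor`.
      right-of-h : ∀ {r} → R r → Near h r → ¬ D h r → hi h < lo r
      right-of-h {r} Rr near@(x , hx , xr) ¬d with apart ρ (D-refl h) near ¬d
      ... | inj₁ lt = lt
      ... | inj₂ r<h with closed Rr (D-sym xr)
      ...   | inj₂ Rx = contradiction
        (<-≤-trans (right-of-K Rx hx) (proj₁ (touch ρ hx near xr)))
        (≤⇒≯ (≤-trans (<⇒≤ r<h) (lo≤p Kh)))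
      ...   | inj₁ Kx = contradiction (meet ρ hx nearℓ lo-x≤hi-ℓ lo-ℓ≤hi-x) (anchor Kx Rr xr)
        where
        r<g : hi r < lo g
        r<g with apart ρ h∼g near (g-R Rr)
        ... | inj₂ lt = lt
        ... | inj₁ g<r = contradiction
          (≤-<-trans (≤-trans (<⇒≤ r<h) (proj₁ (touch ρ (D-refl h) (D⇒N h∼g) h∼g))) g<r)
          (≤⇒≯ (proj₁ (valid ρ near)))
        lo-x≤hi-ℓ : lo x ≤ hi ℓ
        lo-x≤hi-ℓ = ≤-trans (proj₁ (touch ρ hx near xr)) (≤-trans (<⇒≤ r<g) lo-g≤hi-ℓ)
        lo-ℓ≤hi-x : lo ℓ ≤ hi x
        lo-ℓ≤hi-x = ≤-trans (proj₁ (valid ρ nearℓ))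
                      (≤-trans (<⇒≤ ℓ-left) (≤-trans (lo≤p Kh) (p≤hi Kx)))

      K′ R′ : A → Set
      K′ x = D h x × q ≤ hi x
      R′ x = R x × ¬ D h x

      K′? : ∀ x → Dec (K′ x)
      K′? x = D? h x ×-dec q ≤? hi x

      closed′ : ∀ {x y} → R′ x → D x y → K′ y ⊎ R′ y
      closed′ {x} {y} (Rx , ¬hx) d with D? h y
      ... | yes hy = inj₁ (hy , ≤-trans q≤hi-h (≤-trans (<⇒≤ (right-of-h Rx near ¬hx))
                                                  (proj₂ (touch ρ hy near (D-sym d)))))
        where
        near : Near h x
        near = y , hy , D-sym d
      ... | no ¬hy with closed Rx d
      ...   | inj₁ Ky = contradiction (h∼ Ky) ¬hy
      ...   | inj₂ Ry = inj₂ (Ry , ¬hy)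

      -- A vertex of K ∩ K′ sees all of R that h sees, so the choice of h
      -- leaves it no further neighbour.
      K∩K′-blind : ∀ {x r} → K x → K′ x → R′ r → ¬ D x r
      K∩K′-blind {x} {r} Kx (hx , q≤) (Rr , ¬hr) xr =
        <⇒≱ (count-mono-< (nbrs? h) (nbrs? x) sub (complete r) (Rr , xr) (λ (_ , d) → ¬hr d))
            (h-max x Kx)
        where
        sub : ∀ y → R y × D h y → R y × D x y
        sub y (Ry , hy) = Ry , meet ρ hx (D⇒N hy)
          (≤-trans (lo≤p Kx) (≤-trans (<⇒≤ (right-of-K Ry hy)) (proj₁ (valid ρ (D⇒N hy)))))
          (≤-trans (lo≤q hy) q≤)

      next : State K′ R′
      next = record
        { K? = K′?
        ; R? = λ x → R? x ×-dec ¬? (D? h x)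
        ; clique = λ (hx , qx) (hy , qy) →
            meet ρ hx (D⇒N hy) (≤-trans (lo≤q hx) qy) (≤-trans (lo≤q hy) qx)
        -- Adjacency to `h` brings `z` into the ball; adjacency to `x*`, which starts at `q`, makes
        -- it reach `q`.
        ; maximal = λ f → let hz = f (D-refl h , q≤hi-h) in
            hz , proj₁ (touch ρ h∼x* (D⇒N hz) (f (h∼x* , proj₁ (valid ρ (D⇒N h∼x*)))))
        ; R∩K = λ (_ , ¬d) (d , _) → ¬d d
        ; closed = closed′
        ; g = h
        ; ℓ = g
        ; g∈K = D-refl h , q≤hi-h
        ; g-R = proj₂
        ; ℓ-g = D-sym h∼g
        ; anchor = anchor′
        }
        where
        anchor′ : ∀ {x r} → K′ x → R′ r → D x r → ¬ D x g
        anchor′ {x} K′x R′r xr xg with closed (proj₁ R′r) (D-sym xr)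
        ... | inj₁ Kx = K∩K′-blind Kx K′x R′r xr
        ... | inj₂ Rx = g-R Rx (D-sym xg)

      lo-K≤hi : ∀ {x y} → K x → K y ⊎ R y → D h y → lo x ≤ hi y
      lo-K≤hi Kx (inj₁ Ky) hy = ≤-trans (lo≤p Kx) (p≤hi Ky)
      lo-K≤hi Kx (inj₂ Ry) hy =
        ≤-trans (lo≤p Kx) (≤-trans (<⇒≤ (right-of-K Ry hy)) (proj₁ (valid ρ (D⇒N hy))))

      -- The new representation lists the positions 0 … q of ρ, with the vertices
      -- of K extended to position 0, followed by those of the recursive call.
      module Glue (J : Swept D K′ R′) where
        open Swept J using () renaming
          (S to S′; S? to S′?; lo to lo′; hi to hi′; S⊆R to S′⊆R; lo-K to lo′-K)

        S : A → Set
        S x = (R x × D h x) ⊎ S′ x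

        S⇒R : ∀ {x} → S x → R x
        S⇒R (inj₁ (Rx , _)) = Rx
        S⇒R (inj₂ s) = proj₁ (S′⊆R s)

        -- The seam is at `q`: intervals end before it, run across it, or belong entirely to the
        -- recursive call.
        data Kind (x : A) : Set where
          first  : D h x → hi x < q → Kind x
          both   : K′ x → Kind x
          second : S′ x → Kind x

        kind : ∀ {x} → K x ⊎ S x → Kind x
        kind {x} (inj₂ (inj₂ s)) = second s
        kind {x} (inj₂ (inj₁ (_ , hx))) with q ≤? hi x
        ... | yes p = both (hx , p)
        ... | no p = first hx (≰⇒> p)
        kind {x} (inj₁ Kx) with q ≤? hi x
        ... | yes p = both (h∼ Kx , p)
        ... | no p = first (h∼ Kx) (≰⇒> p)

        KR : ∀ {x} → K x ⊎ S x → K x ⊎ R x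
        KR (inj₁ k) = inj₁ k
        KR (inj₂ s) = inj₂ (S⇒R s)

        lo₁ : A → ℕ
        lo₁ x with K? x
        ... | yes _ = 0
        ... | no _ = lo x

        newLo newHi : A → ℕ
        newLo x with D? h x
        ... | yes _ = lo₁ x
        ... | no _ = suc q + lo′ x
        newHi x with K′? x
        ... | yes _ = suc q + hi′ x
        ... | no _ with D? h x
        ...   | yes _ = hi x
        ...   | no _ = suc q + hi′ x

        newLo-h : ∀ {x} → D h x → newLo x ≡ lo₁ x
        newLo-h {x} d with D? h x
        ... | yes _ = refl
        ... | no ¬d = contradiction d ¬d

        newLo-¬h : ∀ {x} → S′ x → newLo x ≡ suc q + lo′ x
        newLo-¬h {x} s with D? h x
        ... | yes d = contradiction d (proj₂ (S′⊆R s))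
        ... | no ¬d = refl

        newHi-first : ∀ {x} → D h x → hi x < q → newHi x ≡ hi x
        newHi-first {x} d lt with K′? x
        ... | yes (_ , ge) = contradiction ge (<⇒≱ lt)
        ... | no _ with D? h x
        ...   | yes _ = refl
        ...   | no ¬d = contradiction d ¬d

        newHi-K′ : ∀ {x} → K′ x → newHi x ≡ suc q + hi′ x
        newHi-K′ {x} k with K′? x
        ... | yes _ = refl
        ... | no ¬k = contradiction k ¬k

        newHi-S′ : ∀ {x} → S′ x → newHi x ≡ suc q + hi′ x
        newHi-S′ {x} s with K′? x
        ... | yes k = refl
        ... | no _ with D? h x
        ...   | yes d = contradiction d (proj₂ (S′⊆R s))
        ...   | no _ = refl

        lo₁≤lo : ∀ {x} → lo₁ x ≤ lo x
        lo₁≤lo {x} with K? x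
        ... | yes _ = z≤n
        ... | no _ = ≤-refl

        -- Extending `K` to position 0 creates no new overlap: a member of `K` starts no later than
        -- `p`, and every interval concerned ends at `p` or later.
        lo≤hi⇐ : ∀ {x y} → K y ⊎ R y → D h y → lo₁ x ≤ hi y → lo x ≤ hi y
        lo≤hi⇐ {x} Ky hy p with K? x
        ... | yes Kx = lo-K≤hi Kx Ky hy
        ... | no _ = p

        lo₁≤q : ∀ {x} → D h x → lo₁ x ≤ q
        lo₁≤q d = ≤-trans lo₁≤lo (lo≤q d)

        first-S′ : ∀ {x y} → D h x → hi x < q → S′ y → ¬ D y x
        first-S′ hx lt s d with closed′ (S′⊆R s) d
        ... | inj₁ (_ , ge) = <⇒≱ lt ge
        ... | inj₂ (_ , ¬hx) = ¬hx hx

        past : ∀ {a b} → a ≤ q → a ≤ suc q + b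
        past a≤q = ≤-trans a≤q (≤-trans (n≤1+n q) (m≤m+n (suc q) _))

        touchK : ∀ {x y} → Kind x → Kind y → D x y → newLo x ≤ newHi y
        touchK (first hx ltx) (first hy lty) d rewrite newLo-h hx | newHi-first hy lty =
          ≤-trans lo₁≤lo (proj₁ (touch ρ hx (D⇒N hy) d))
        touchK (first hx ltx) (both ky) d rewrite newLo-h hx | newHi-K′ ky = past (lo₁≤q hx)
        touchK (first hx ltx) (second sy) d = contradiction (D-sym d) (first-S′ hx ltx sy)
        touchK (both kx@(hx , _)) (first hy lty) d rewrite newLo-h hx | newHi-first hy lty =
          ≤-trans lo₁≤lo (proj₁ (touch ρ hx (D⇒N hy) d))
        touchK (both kx@(hx , _)) (both ky) d rewrite newLo-h hx | newHi-K′ ky = past (lo₁≤q hx)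
        touchK (both kx@(hx , _)) (second sy) d rewrite newLo-h hx | newHi-S′ sy = past (lo₁≤q hx)
        touchK (second sx) (first hy lty) d = contradiction d (first-S′ hy lty sx)
        touchK (second sx) (both ky) d rewrite newLo-¬h sx | newHi-K′ ky =
          +-monoʳ-≤ (suc q) (Swept.touch J (inj₂ sx) (inj₁ ky) d)
        touchK (second sx) (second sy) d rewrite newLo-¬h sx | newHi-S′ sy =
          +-monoʳ-≤ (suc q) (Swept.touch J (inj₂ sx) (inj₂ sy) d)

        beyond : ∀ {a b} → a < q → ¬ (suc q + b ≤ a)
        beyond a<q le = <⇒≱ a<q (≤-trans (≤-trans (n≤1+n q) (m≤m+n (suc q) _)) le)

        meetK : ∀ {x y} → K x ⊎ R x → K y ⊎ R y → Kind x → Kind y →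
                newLo x ≤ newHi y → newLo y ≤ newHi x → D x y
        meetK cx cy (first hx ltx) (first hy lty) a b
          rewrite newLo-h hx | newHi-first hy lty | newLo-h hy | newHi-first hx ltx =
          meet ρ hx (D⇒N hy) (lo≤hi⇐ cy hy a) (lo≤hi⇐ cx hx b)
        meetK cx cy (first hx ltx) (both ky@(hy , q≤)) a b
          rewrite newLo-h hy | newHi-first hx ltx =
          meet ρ hx (D⇒N hy) (≤-trans (lo≤q hx) q≤) (lo≤hi⇐ cx hx b)
        meetK cx cy (first hx ltx) (second sy) a b rewrite newHi-first hx ltx | newLo-¬h sy =
          contradiction b (beyond ltx)
        meetK cx cy (both ky@(hx , q≤)) (first hy lty) a b
          rewrite newLo-h hx | newHi-first hy lty =
          meet ρ hx (D⇒N hy) (lo≤hi⇐ cy hy a) (≤-trans (lo≤q hy) q≤)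
        meetK cx cy (both kx) (both ky) a b = State.clique next kx ky
        -- Members of `K′` start at 0 in the recursive layout, so one of the two inequalities asked
        -- for there is automatic.
        meetK cx cy (both kx) (second sy) a b rewrite newHi-K′ kx | newLo-¬h sy =
          Swept.meet J (inj₁ kx) (inj₂ sy) (subst (_≤ hi′ _) (sym (lo′-K kx)) z≤n)
            (+-cancelˡ-≤ (suc q) _ _ b)
        meetK cx cy (second sx) (first hy lty) a b rewrite newHi-first hy lty | newLo-¬h sx =
          contradiction a (beyond lty)
        meetK cx cy (second sx) (both ky) a b rewrite newHi-K′ ky | newLo-¬h sx =
          Swept.meet J (inj₂ sx) (inj₁ ky) (+-cancelˡ-≤ (suc q) _ _ a)
            (subst (_≤ hi′ _) (sym (lo′-K ky)) z≤n)
        meetK cx cy (second sx) (second sy) a b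
          rewrite newHi-S′ sx | newHi-S′ sy | newLo-¬h sx | newLo-¬h sy =
          Swept.meet J (inj₂ sx) (inj₂ sy) (+-cancelˡ-≤ (suc q) _ _ a) (+-cancelˡ-≤ (suc q) _ _ b)

        S-from-R : ∀ {x y} → R y → D x y → (R x × D h x) ⊎ S′ x → S y
        S-from-R {x} {y} Ry d s with D? h y
        ... | yes hy = inj₁ (Ry , hy)
        ... | no ¬hy with s
        ...   | inj₁ (Rx , hx) with closed′ (Ry , ¬hy) (D-sym d)
        ...     | inj₁ K′x = inj₂ (Swept.K-S J K′x (Ry , ¬hy) d)
        ...     | inj₂ (_ , ¬hx) = contradiction hx ¬hx
        S-from-R {x} {y} Ry d s | no ¬hy | inj₂ s′ with Swept.S-closed J s′ d
        ...     | inj₁ (hy , _) = contradiction hy ¬hy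
        ...     | inj₂ s′y = inj₂ s′y

        S-closed : ∀ {x y} → S x → D x y → K y ⊎ S y
        S-closed s d with closed (S⇒R s) d
        ... | inj₁ Ky = inj₁ Ky
        ... | inj₂ Ry = inj₂ (S-from-R Ry d s)

        K-S : ∀ {x y} → K x → R y → D x y → S y
        K-S {x} {y} Kx Ry d with D? h y
        ... | yes hy = inj₁ (Ry , hy)
        ... | no ¬hy with closed′ (Ry , ¬hy) (D-sym d)
        ...   | inj₁ K′x = inj₂ (Swept.K-S J K′x (Ry , ¬hy) d)
        ...   | inj₂ (Rx , _) = contradiction Kx (R∩K Rx)

        lift : ∀ {x} → Chain D K′ x → Chain D K x
        lift (stop (hx , _)) = step (D-sym hx) (stop Kh)
        lift (step d c) = step d (lift c)

        reach : ∀ {x} → S x → Chain D K x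
        reach (inj₁ (_ , hx)) = step (D-sym hx) (stop Kh)
        reach (inj₂ s) = lift (Swept.reach J s)

        lo₁-K : ∀ {x} → K x → lo₁ x ≡ 0
        lo₁-K {x} k with K? x
        ... | yes _ = refl
        ... | no ¬k = contradiction k ¬k

        swept : Swept D K R
        swept = record
          { S = S
          ; S? = λ x → (R? x ×-dec D? h x) ⊎-dec S′? x
          ; S⊆R = S⇒R
          ; S-closed = S-closed
          ; K-S = K-S
          ; reach = reach
          ; lo = newLo
          ; hi = newHi
          ; touch = λ cx cy → touchK (kind cx) (kind cy)
          ; meet = λ cx cy → meetK (KR cx) (KR cy) (kind cx) (kind cy)
          ; lo-K = λ k → trans (newLo-h (h∼ k)) (lo₁-K k)
          }

      shrinks : count (State.R? next) elems < count R? elems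
      shrinks = count-mono-< (State.R? next) R? (λ _ → proj₁) (complete r₀) Rr₀ (λ (_ , ¬d) → ¬d h-r₀)

  -- A near vertex not adjacent to `h` lies wholly on one side of it; mirroring makes that side the
  -- left.
  orient : ∀ {h ℓ} → Near h ℓ → ¬ D h ℓ → ∃[ ρ ] (LocalRep.hi {h} ρ ℓ < LocalRep.lo {h} ρ h)
  orient {h} {ℓ} n ¬d with apart (rep h) (D-refl h) n ¬d
  ... | inj₂ lt = rep h , lt
  ... | inj₁ lt = flip D-refl (rep h) , ∸-monoʳ-< lt (≤-trans (proj₁ v) (proj₂ v))
    where
    v = valid (rep h) n

  -- The fuel bounds the size of `R`, which drops at every step because `r₀` is adjacent to `h` and
  -- so leaves it.
  sweep-fuel : ∀ fuel {K R} (st : State K R) → count (State.R? st) elems < fuel → Swept D K R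
  sweep-fuel (suc fuel) {K} {R} st bound
    with ∃? (λ x → ∃? (λ r → State.K? st x ×-dec State.R? st r ×-dec D? x r))
  -- Nothing in `R` touches `K`: the layout is the single point 0, occupied by `K`.
  ... | no none = record
    { S = λ _ → ⊥
    ; S? = λ _ → no λ ()
    ; S⊆R = λ ()
    ; S-closed = λ ()
    ; K-S = λ k r d → none (_ , _ , k , r , d)
    ; reach = λ ()
    ; lo = λ _ → 0
    ; hi = λ _ → 0
    ; touch = λ _ _ _ → z≤n
    ; meet = λ { (inj₁ k) (inj₁ k′) _ _ → State.clique st k k′ }
    ; lo-K = λ _ → refl
    }
  ... | yes (x , r , Kx , Rr , xr) = Adv.Glue.swept (sweep-fuel fuel Adv.next (<-≤-trans Adv.shrinks (≤-pred bound)))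
    where
    open State st
    open Step st using (score; nbrs?)
    best = argmax K? score (x , Kx)
    h = proj₁ best
    Kh = proj₁ (proj₂ best)
    h-max = proj₂ (proj₂ best)
    -- `r` makes the score of `x` positive, hence also the maximal score, so `h` itself has a
    -- neighbour in `R`.
    wit = count-witness (nbrs? h) elems
            (<-≤-trans (count-pos (nbrs? x) (complete r) (Rr , xr)) (h-max x Kx))
    r₀ = proj₁ wit
    Rr₀ = proj₁ (proj₂ wit)
    h-r₀ = proj₂ (proj₂ wit)
    oriented = orient (g , clique Kh g∈K , D-sym ℓ-g) (anchor Kh Rr₀ h-r₀)
    module Adv = Step.Advance st Kh h-max Rr₀ h-r₀ (proj₁ oriented) (proj₂ oriented)

  sweep : ∀ {K R} → State K R → Swept D K R
  sweep st = sweep-fuel _ st ≤-refl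

-- Cocycles on locally interval graphs

-- A cocycle on an interval family is a coboundary: choose a base vertex at every
-- point of the path and transport from each point to the next.
module Potential {A : Set} (fin : Finite A) {V : A → Set} (V? : ∀ x → Dec (V x))
                 (lo hi : A → ℕ) (lo≤hi : ∀ x → V x → lo x ≤ hi x) (w : A → A → ℤ) where
  open FiniteSearch fin

  At : ℕ → A → Set
  At t x = V x × lo x ≤ t × t ≤ hi x

  At? : ∀ t x → Dec (At t x)
  At? t x = V? x ×-dec lo x ≤? t ×-dec t ≤? hi x

  module _ (cocycle : ∀ {t x y z} → At t x → At t y → At t z → w x y ⊕ w y z ≡ w x z) where

    fromBase : ℕ → A → ℤ
    fromBase t x with ∃? (At? t)
    ... | yes (b , _) = w b x
    ... | no _ = 0ℤ

    fromBase-w : ∀ {t x y} → At t x → At t y → fromBase t x ⊕ w x y ≡ fromBase t y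
    fromBase-w {t} {x} ax ay with ∃? (At? t)
    ... | yes (b , ab) = cocycle ab ax ay
    ... | no none = contradiction (x , ax) none

    -- The change of coordinates between the base vertices at `t` and `suc t`, read off any vertex
    -- present at both; `link-w` shows that the choice is immaterial. If there is none, nothing
    -- relates the two points and 0 serves.
    link : ℕ → ℤ
    link t with ∃? (λ z → At? t z ×-dec At? (suc t) z)
    ... | yes (z , _) = fromBase t z ⊖ fromBase (suc t) z
    ... | no _ = 0ℤ

    level : ℕ → ℤ
    level zero = 0ℤ
    level (suc t) = level t ⊕ link t

    link-w : ∀ {t x} → At t x → At (suc t) x →
             level t ⊕ fromBase t x ≡ level (suc t) ⊕ fromBase (suc t) x
    link-w {t} {x} ax ax′ with ∃? (λ z → At? t z ×-dec At? (suc t) z)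
    ... | no none = contradiction (x , ax , ax′) none
    ... | yes (z , az , az′) = begin
      level t ⊕ fromBase t x
        ≡⟨ cong (level t ⊕_) (sym (fromBase-w az ax)) ⟩
      level t ⊕ (fromBase t z ⊕ w z x)
        ≡⟨ rearrange (level t) (fromBase t z) (fromBase (suc t) z) (w z x) ⟩
      (level t ⊕ (fromBase t z ⊖ fromBase (suc t) z)) ⊕ (fromBase (suc t) z ⊕ w z x)
        ≡⟨ cong ((level t ⊕ (fromBase t z ⊖ fromBase (suc t) z)) ⊕_) (fromBase-w az′ ax′) ⟩
      (level t ⊕ (fromBase t z ⊖ fromBase (suc t) z)) ⊕ fromBase (suc t) x ∎
      where
      open ≡-Reasoning
      rearrange : ∀ l a b c → l ⊕ (a ⊕ c) ≡ (l ⊕ (a ⊖ b)) ⊕ (b ⊕ c)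
      rearrange = ℤ-Solver.solve-∀

    potential : A → ℤ
    potential x = level (lo x) ⊕ fromBase (lo x) x

    potential-at : ∀ {x} d → At (d + lo x) x →
                   potential x ≡ level (d + lo x) ⊕ fromBase (d + lo x) x
    potential-at zero _ = refl
    potential-at {x} (suc d) a@(v , _ , le) =
      trans (potential-at d a′) (link-w a′ a)
      where
      a′ : At (d + lo x) x
      a′ = v , m≤n+m (lo x) d , ≤-trans (n≤1+n _) le

    potential-w : ∀ {t x y} → At t x → At t y → potential x ⊕ w x y ≡ potential y
    potential-w {t} {x} {y} ax@(_ , lx , _) ay@(_ , ly , _) = begin
      potential x ⊕ w x y                   ≡⟨ cong (_⊕ w x y) (at ax lx) ⟩
      level t ⊕ fromBase t x ⊕ w x y      ≡⟨ ℤ.+-assoc (level t) (fromBase t x) (w x y) ⟩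
      level t ⊕ (fromBase t x ⊕ w x y)    ≡⟨ cong (level t ⊕_) (fromBase-w ax ay) ⟩
      level t ⊕ fromBase t y                ≡⟨ sym (at ay ly) ⟩
      potential y ∎
      where
      open ≡-Reasoning
      at : ∀ {z} → At t z → lo z ≤ t → potential z ≡ level t ⊕ fromBase t z
      at {z} a l = subst (λ t → At t z → potential z ≡ level t ⊕ fromBase t z)
                     (m∸n+n≡m l) (potential-at (t ∸ lo z)) a

finFin : ∀ n → Finite (Fin n)
finFin n = record { elems = allFin n ; complete = ∈-allFin }

-- Walks, distances and balls

module Graphs {n : ℕ} (G : Graph n) where

  D : Fin n → Fin n → Set
  D x y = x ≡ y ⊎ Edge G x y

  Edge? : ∀ x y → Dec (Edge G x y)
  Edge? x y = adj G x y Bool.≟ true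

  Edge-sym : ∀ {x y} → Edge G x y → Edge G y x
  Edge-sym {x} {y} e = trans (Graph.sym G y x) e

  D? : ∀ x y → Dec (D x y)
  D? x y = (x Fin.≟ y) ⊎-dec Edge? x y

  D-refl : ∀ x → D x x
  D-refl _ = inj₁ refl

  D-sym : ∀ {x y} → D x y → D y x
  D-sym (inj₁ e) = inj₁ (sym e)
  D-sym (inj₂ e) = inj₂ (Edge-sym e)

  -- Steps follow the reflexive `D` and may stand still, so the length only bounds that of the
  -- underlying walk.
  data Path (w : Fin n → Fin n → ℤ) (x : Fin n) : Fin n → ℕ → ℤ → Set where
    nil  : Path w x x 0 0ℤ
    snoc : ∀ {y z k s} → Path w x y k s → D y z → Path w x z (suc k) (s ⊕ w y z)

  walk-snoc : ∀ {x y z k} → Walk G x y k → Edge G y z → Walk G x z (suc k)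
  walk-snoc here e = step e here
  walk-snoc (step e p) f = step e (walk-snoc p f)

  walk-reverse : ∀ {x y k} → Walk G x y k → Walk G y x k
  walk-reverse here = here
  walk-reverse (step e p) = walk-snoc (walk-reverse p) (Edge-sym e)

  walk? : ∀ x y k → Dec (Walk G x y k)
  walk? x y zero = map′ (λ { refl → here }) (λ { here → refl }) (x Fin.≟ y)
  walk? x y (suc k) = map′ (λ (_ , e , p) → step e p) (λ { (step e p) → _ , e , p })
    (Fin.any? (λ z → Edge? x z ×-dec walk? z y k))

  -- An upward search from the known lower bound `l`; the given walk of length `k + l` limits it to
  -- `k` steps.
  least : ∀ {x y} k l → (∀ j → Walk G x y j → l ≤ j) → Walk G x y (k + l) → ∃[ d ] Dist G x y d
  least zero l below p = l , p , below
  least {x} {y} (suc k) l below p with walk? x y l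
  ... | yes q = l , q , below
  ... | no ¬q = least k (suc l) below′ (subst (Walk G x y) (sym (+-suc k l)) p)
    where
    below′ : ∀ j → Walk G x y j → suc l ≤ j
    below′ j q = ≤∧≢⇒< (below j q) (λ { refl → ¬q q })

  dist : ∀ {x y k} → Walk G x y k → ∃[ d ] (Dist G x y d × d ≤ k)
  dist {x} {y} {k} p =
    let d , D@(_ , min) = least k 0 (λ _ _ → z≤n) (subst (Walk G x y) (sym (+-identityʳ k)) p)
    in d , D , min k p

  Dist-unique : ∀ {x y a b} → Dist G x y a → Dist G x y b → a ≡ b
  Dist-unique (p , min) (q , min′) = ≤-antisym (min _ q) (min′ _ p)

  path⇒walk : ∀ {w x y k s} → Path w x y k s → ∃[ j ] (Walk G x y j × j ≤ k)
  path⇒walk nil = 0 , here , z≤n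
  path⇒walk (snoc p d) with path⇒walk p
  path⇒walk (snoc p (inj₁ refl)) | j , q , le = j , q , m≤n⇒m≤1+n le
  path⇒walk (snoc p (inj₂ e)) | j , q , le = suc j , walk-snoc q e , s≤s le

  halve : ∀ {a r} → a + a ≤ r → a ≤ r / 2
  halve {a} {r} le = subst (_≤ r / 2) (m*n/n≡m a 2) (/-monoˡ-≤ 2 (subst (_≤ r) a+a≡a*2 le))
    where
    a+a≡a*2 : a + a ≡ a * 2
    a+a≡a*2 = trans (cong (a +_) (sym (+-identityʳ a))) (*-comm 2 a)

  module LocallyIntervalGraph {r : ℕ} (conn : Connected G) (4≤r : 4 ≤ r)
                              (int : LocallyInterval r G) where
    open Local D
    open FiniteSearch (finFin n)

    module Rep (v : Fin n) = IntervalRep (int v)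

    equal-or : ∀ {v x y} → BallVertex G v r x → (x ≢ y → Rep.lo v x ≤ Rep.hi v y × Rep.lo v y ≤ Rep.hi v x) →
               D x y → Rep.lo v x ≤ Rep.hi v y × Rep.lo v y ≤ Rep.hi v x
    equal-or {v} {x} {y} bx f d with x Fin.≟ y
    ... | yes refl = proj₁ (Rep.valid v x bx) , proj₁ (Rep.valid v x bx)
    ... | no ne = f ne

    edge-of : ∀ {x y} → D x y → x ≢ y → Edge G x y
    edge-of (inj₁ e) ne = contradiction e ne
    edge-of (inj₂ e) _ = e

    D-dist : ∀ {h x} → D h x → ∃[ a ] (Dist G h x a × a ≤ 1)
    D-dist (inj₁ refl) = let a , d , le = dist here in a , d , ≤-trans le z≤n
    D-dist (inj₂ e) = dist (step e here)

    Near-dist : ∀ {h y} → Near h y → ∃[ a ] (Dist G h y a × a ≤ 2)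
    Near-dist (x , inj₁ refl , d) = let a , D , le = D-dist d in a , D , m≤n⇒m≤1+n le
    Near-dist (x , inj₂ e , inj₁ refl) = let a , D , le = dist (step e here) in a , D , m≤n⇒m≤1+n le
    Near-dist (x , inj₂ e , inj₂ e′) = dist (step e (step e′ here))

    near-ball : ∀ {h y} → Near h y → BallVertex G h r y
    near-ball ny = let b , db , b≤2 = Near-dist ny in
      b , db , ≤-trans b≤2 (halve {2} 4≤r)

    -- Both uses of `4 ≤ r` are here: distance two is within the radius `r / 2`, and distances at
    -- most one and two add up to less than `r`, so the ball contains every edge that `touch` and
    -- `meet` speak of.
    localRep : ∀ h → LocalRep h
    localRep h = record
      { lo = Rep.lo h
      ; hi = Rep.hi h
      ; top = Rep.m h
      ; valid = λ ny → let l , u = Rep.valid h _ (near-ball ny) in l , <⇒≤ u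
      ; touch = λ {x} {y} hx ny d → equal-or {h} (near-ball (D⇒Near D-refl hx)) (λ ne →
          Equivalence.to (Rep.repr h x y (near-ball (D⇒Near D-refl hx)) (near-ball ny) ne)
            (edge-of d ne , close hx ny)) d
      ; meet = meet
      }
      where
      close : ∀ {x y} → D h x → Near h y → ∃[ a ] ∃[ b ] (Dist G h x a × Dist G h y b × a + b < r)
      close hx ny = let a , da , la = D-dist hx ; b , db , lb = Near-dist ny in
        a , b , da , db , <-≤-trans (s≤s (+-mono-≤ la lb)) 4≤r
      meet : ∀ {x y} → D h x → Near h y → Rep.lo h x ≤ Rep.hi h y → Rep.lo h y ≤ Rep.hi h x → D x y
      meet {x} {y} hx ny p q with x Fin.≟ y
      ... | yes e = inj₁ e
      ... | no ne = inj₂ (proj₁ (Equivalence.from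
              (Rep.repr h x y (near-ball (D⇒Near D-refl hx)) (near-ball ny) ne) (p , q)))

    module Closed (w : Fin n → Fin n → ℤ)
                  (cocycle : ∀ {x y z} → D x y → D y z → D x z → w x y ⊕ w y z ≡ w x z) where

      w-self : ∀ x → w x x ≡ 0ℤ
      w-self x = identityʳ-unique (w x x) (w x x) (cocycle (D-refl x) (D-refl x) (D-refl x))

      module At (v : Fin n) where
        V? : ∀ x → Dec (BallVertex G v r x)
        V? x with dist (proj₂ (conn v x))
        ... | d , D , _ with d ≤? r / 2
        ...   | yes le = yes (d , D , le)
        ...   | no nle = no λ (k , D′ , le) → nle (subst (_≤ r / 2) (Dist-unique D′ D) le)

        open Potential (finFin n) V? (Rep.lo v) (Rep.hi v) (λ x b → proj₁ (Rep.valid v x b)) w public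

        At⇒D : ∀ {t x y} → At t x → At t y → D x y
        At⇒D {t} {x} {y} (bx , lx , ux) (by , ly , uy) with x Fin.≟ y
        ... | yes e = inj₁ e
        ... | no ne = inj₂ (proj₁ (Equivalence.from (Rep.repr v x y bx by ne)
                        (≤-trans lx uy , ≤-trans ly ux)))

        cocycleAt : ∀ {t x y z} → At t x → At t y → At t z → w x y ⊕ w y z ≡ w x z
        cocycleAt ax ay az = cocycle (At⇒D ax ay) (At⇒D ay az) (At⇒D ax az)

        φ : Fin n → ℤ
        φ = potential cocycleAt

        -- The distances `a`, `b` of the ends from `v` differ by at most one and satisfy
        -- `a + b < r`, so each is at most `r / 2`. The edge thus belongs to the ball, and the two
        -- intervals share the larger of their starting points.
        φ-edge : ∀ {x y j m} → Walk G v x j → Walk G v y m → suc (j + m) ≤ r → D x y →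
                 φ x ⊕ w x y ≡ φ y
        φ-edge {x} p q le (inj₁ refl) = trans (cong (φ x ⊕_) (w-self x)) (ℤ.+-identityʳ _)
        φ-edge {x} {y} {j} {m} p q le (inj₂ e) with x Fin.≟ y
        ... | yes refl = trans (cong (φ x ⊕_) (w-self x)) (ℤ.+-identityʳ _)
        ... | no ne = potential-w cocycleAt
              (bx , m≤m⊔n _ _ , ⊔-lub (proj₁ (Rep.valid v x bx)) (proj₂ lohi))
              (by , m≤n⊔m _ _ , ⊔-lub (proj₁ lohi) (proj₁ (Rep.valid v y by)))
          where
          dx = dist p
          dy = dist q
          a = proj₁ dx
          b = proj₁ dy
          a≤1+b : a ≤ suc b
          a≤1+b = proj₂ (proj₁ (proj₂ dx)) _ (walk-snoc (proj₁ (proj₁ (proj₂ dy))) (Edge-sym e))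
          b≤1+a : b ≤ suc a
          b≤1+a = proj₂ (proj₁ (proj₂ dy)) _ (walk-snoc (proj₁ (proj₁ (proj₂ dx))) e)
          a+b<r : suc (a + b) ≤ r
          a+b<r = ≤-trans (s≤s (+-mono-≤ (proj₂ (proj₂ dx)) (proj₂ (proj₂ dy)))) le
          bx : BallVertex G v r x
          bx = a , proj₁ (proj₂ dx) , halve (≤-trans (+-monoʳ-≤ a a≤1+b) (subst (_≤ r) (sym (+-suc a b)) a+b<r))
          by : BallVertex G v r y
          by = b , proj₁ (proj₂ dy) , halve (≤-trans (+-monoˡ-≤ b b≤1+a) a+b<r)
          lohi : Rep.lo v x ≤ Rep.hi v y × Rep.lo v y ≤ Rep.hi v x
          lohi = Equivalence.to (Rep.repr v x y bx by ne) (e , a , b , proj₁ (proj₂ dx) , proj₁ (proj₂ dy) , a+b<r)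

        -- The walk `q` stands for the way back to `v`. For each step, one end is reached along the
        -- path and the other along the way back; as the total is at most `r`, these lengths add up
        -- to less than `r` and `φ-edge` applies. Dropping the last step of the path lengthens the
        -- way back by at most one.
        path-sum : ∀ {x k m s} → Path w v x k s → Walk G v x m → k + m ≤ r → φ v ⊕ s ≡ φ x
        path-sum nil q le = ℤ.+-identityʳ _
        path-sum {m = m} (snoc {y} {z} {k} {s} p d) q le = begin
          φ v ⊕ (s ⊕ w y z)  ≡⟨ sym (ℤ.+-assoc (φ v) s (w y z)) ⟩
          φ v ⊕ s ⊕ w y z    ≡⟨ cong (_⊕ w y z) (earlier d) ⟩
          φ y ⊕ w y z          ≡⟨ φ-edge (proj₁ (proj₂ pw)) q (≤-trans (s≤s (+-monoˡ-≤ m (proj₂ (proj₂ pw)))) le) d ⟩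
          φ z ∎
          where
          open ≡-Reasoning
          pw = path⇒walk p
          earlier : D y z → φ v ⊕ s ≡ φ y
          earlier (inj₁ refl) = path-sum p q (≤-trans (n≤1+n _) le)
          earlier (inj₂ e) = path-sum p (walk-snoc q (Edge-sym e)) (subst (_≤ r) (sym (+-suc k m)) le)

      closed-sum : ∀ {v k s} → Path w v v k s → k ≤ r → s ≡ 0ℤ
      closed-sum {v} {k} {s} p le = identityʳ-unique (At.φ v v) s
        (At.path-sum v p here (subst (_≤ r) (sym (+-identityʳ k)) le))

-- The cyclic cover and the sweep around it

finBool : ∀ n → Finite (Fin n × Bool)
finBool n = record
  { elems = cartesianProduct (allFin n) (true ∷ false ∷ [])
  ; complete = λ { (x , true) → ∈-cartesianProduct⁺ (∈-allFin x) (here refl)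
                 ; (x , false) → ∈-cartesianProduct⁺ (∈-allFin x) (there (here refl)) }
  }

data Zone : Set where
  inside left other : Zone

-- The sign is such that leaving `N` on the right and coming back on the left counts as one.
turn : Zone → Zone → ℤ
turn left inside = 1ℤ
turn inside left = -1ℤ
turn _ _ = 0ℤ

lv : Bool → ℤ
lv false = 0ℤ
lv true = 1ℤ

module Around {n : ℕ} (G : Graph n) {r : ℕ} (conn : Connected G) (4≤r : 4 ≤ r)
              (int : LocallyInterval r G) (o : Fin n) where
  open Graphs G
  open LocallyIntervalGraph conn 4≤r int
  open Local D
  open FiniteSearch (finFin n)

  N : Fin n → Set
  N = D o

  N? : ∀ x → Dec (N x)
  N? = D? o

  -- The rest of the graph laid out on 0 … P, from the right of o around to its left:
  -- re x is the end of the arc leaving x ∈ N on the right of o, le x the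
  -- start of the arc that enters x on the left.
  record TwoEnd (ρ : LocalRep o) : Set where
    open LocalRep ρ using (lo; hi)
    field
      P           : ℕ
      lo₂ hi₂     : Fin n → ℕ
      re le       : Fin n → ℕ
      lo≤hi       : ∀ {r} → ¬ N r → lo₂ r ≤ hi₂ r
      hi≤P        : ∀ {r} → ¬ N r → hi₂ r ≤ P
      re≤P        : ∀ {x} → N x → hi o < hi x → re x ≤ P
      le≤P        : ∀ {x} → N x → le x ≤ P
      out-touch   : ∀ {r s} → ¬ N r → ¬ N s → D r s → lo₂ r ≤ hi₂ s
      out-meet    : ∀ {r s} → ¬ N r → ¬ N s → lo₂ r ≤ hi₂ s → lo₂ s ≤ hi₂ r → D r s
      right-touch : ∀ {x r} → N x → ¬ N r → D x r → hi o < lo r → lo₂ r ≤ re x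
      right-meet  : ∀ {x r} → N x → ¬ N r → hi o < hi x → lo₂ r ≤ re x → D x r × hi o < lo r
      left-touch  : ∀ {x r} → N x → ¬ N r → D x r → hi r < lo o → le x ≤ hi₂ r
      left-meet   : ∀ {x r} → N x → ¬ N r → lo x < lo o → le x ≤ hi₂ r → D x r × hi r < lo o
      cross       : ∀ {x y} → N x → N y → hi o < hi x → lo y < lo o → re x < le y

  -- The outcome of a sweep that stops without returning to `N`: `S` is the part of the rest
  -- attached on the right of `o`, and `re₁ x` is the end of the arc of `x` within it.
  record OneEnd (ρ : LocalRep o) : Set₁ where
    open LocalRep ρ using (lo; hi)
    field
      S           : Fin n → Set
      S?          : ∀ x → Dec (S x)
      S-out       : ∀ {x} → S x → ¬ N x
      S-closed    : ∀ {x y} → S x → D x y → ¬ N y → S y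
      right-S     : ∀ {x r} → N x → ¬ N r → D x r → hi o < lo r → S r
      S-right     : ∀ {x r} → N x → S r → D x r → hi o < lo r
      lo₁ hi₁ re₁ : Fin n → ℕ
      bound       : ℕ
      hi₁≤bound   : ∀ x → hi₁ x ≤ bound
      re₁≤bound   : ∀ x → re₁ x ≤ bound
      touch₁      : ∀ {r s} → S r → S s → D r s → lo₁ r ≤ hi₁ s
      meet₁       : ∀ {r s} → S r → S s → lo₁ r ≤ hi₁ s → lo₁ s ≤ hi₁ r → D r s
      right-touch : ∀ {x r} → N x → S r → D x r → lo₁ r ≤ re₁ x
      right-meet  : ∀ {x r} → N x → S r → hi o < hi x → lo₁ r ≤ re₁ x → D x r

  module Side (o-max : ∀ x → count (D? x) elems ≤ count N? elems) (ρ : LocalRep o) where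
    open LocalRep ρ

    near : ∀ {x r} → N x → D x r → Near o r
    near {x} d e = x , d , e

    nearN : ∀ {x} → N x → Near o x
    nearN = D⇒Near D-refl

    lo≤hi-o : ∀ {x} → N x → lo x ≤ hi o
    lo≤hi-o Nx = proj₂ (touch (D-refl o) (nearN Nx) Nx)

    lo-o≤hi : ∀ {x} → N x → lo o ≤ hi x
    lo-o≤hi Nx = proj₁ (touch (D-refl o) (nearN Nx) Nx)

    -- The closed neighbourhood of `x` would contain `N` and also `r`, against the maximality of
    -- `o`.
    not-dominating : ∀ {x r} → ¬ N r → D x r → ¬ (∀ {y} → N y → D x y)
    not-dominating {x} {r} ¬Nr d dom =
      <⇒≱ (count-mono-< N? (D? x) (λ _ → dom) (complete r) d ¬Nr) (o-max x)

    right-or-left : ∀ {x r} → N x → ¬ N r → D x r → hi o < lo r ⊎ hi r < lo o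
    right-or-left Nx ¬Nr d = apart (D-refl o) (near Nx d) ¬Nr

    left⇒lo< : ∀ {x r} → N x → D x r → hi r < lo o → lo x < lo o
    left⇒lo< Nx d = ≤-<-trans (proj₁ (touch Nx (near Nx d) d))

    right⇒<hi : ∀ {x r} → N x → D x r → hi o < lo r → hi o < hi x
    right⇒<hi Nx d lt = <-≤-trans lt (proj₂ (touch Nx (near Nx d) d))

    -- Such an `x` reaches past both ends of `o`, hence meets everything that meets `o`.
    not-both : ∀ {x r s} → N x → ¬ N r → D x r → hi r < lo o → D x s → ¬ (hi o < lo s)
    not-both Nx ¬Nr xr rl xs sr = not-dominating ¬Nr xr λ Ny → meet Nx (nearN Ny)
      (≤-trans (<⇒≤ (left⇒lo< Nx xr rl)) (lo-o≤hi Ny))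
      (≤-trans (lo≤hi-o Ny) (<⇒≤ (right⇒<hi Nx xs sr)))

    z-arg : ∃[ z ] (N z × (∀ x → N x → lo x ≤ lo z))
    z-arg = argmax N? lo (o , D-refl o)

    ℓ-arg : ∃[ z ] (N z × (∀ x → N x → hi z ≤ hi x))
    ℓ-arg = argmin N? hi (o , D-refl o)

    z ℓ : Fin n
    z = proj₁ z-arg
    ℓ = proj₁ ℓ-arg

    Nz : N z
    Nz = proj₁ (proj₂ z-arg)

    Nℓ : N ℓ
    Nℓ = proj₁ (proj₂ ℓ-arg)

    -- `z` is the neighbour of `o` that starts last. An interval that starts before `o` and reaches
    -- `z` extends from before the start of `o` to the last start in `N`, so it meets all of `N`.
    left-avoids-z : ∀ {x r} → N x → ¬ N r → D x r → hi r < lo o → ¬ D x z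
    left-avoids-z Nx ¬Nr xr rl xz = not-dominating ¬Nr xr λ {y} Ny → meet Nx (nearN Ny)
      (≤-trans (<⇒≤ (left⇒lo< Nx xr rl)) (lo-o≤hi Ny))
      (≤-trans (proj₂ (proj₂ z-arg) y Ny) (proj₂ (touch Nx (nearN Nz) xz)))

    right-avoids-ℓ : ∀ {x r} → N x → ¬ N r → D x r → hi o < lo r → ¬ D x ℓ
    right-avoids-ℓ Nx ¬Nr xr rr xℓ = not-dominating ¬Nr xr λ {y} Ny → meet Nx (nearN Ny)
      (≤-trans (proj₁ (touch Nx (nearN Nℓ) xℓ)) (proj₂ (proj₂ ℓ-arg) y Ny))
      (≤-trans (lo≤hi-o Ny) (<⇒≤ (right⇒<hi Nx xr rr)))

    -- For vertices not near `o` the bounds of `ρ` mean nothing, and their zone is arbitrary. This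
    -- is harmless: `turn` separates `left` from `other` only against `inside`, so only neighbours
    -- of `N` matter.
    data InZone (x : Fin n) : Zone → Set where
      inside : N x → InZone x inside
      left   : ¬ N x → hi x < lo o → InZone x left
      other  : ¬ N x → ¬ (hi x < lo o) → InZone x other

    zoned : ∀ x → ∃ (InZone x)
    zoned x with N? x | hi x <? lo o
    ... | yes Nx | _ = inside , inside Nx
    ... | no ¬Nx | yes l = left , left ¬Nx l
    ... | no ¬Nx | no ¬l = other , other ¬Nx ¬l

    abstract
      zone : Fin n → Zone
      zone x = proj₁ (zoned x)

      zone-unique : ∀ {x a b} → InZone x a → InZone x b → a ≡ b
      zone-unique (inside _) (inside _) = refl
      zone-unique (inside p) (left q _) = contradiction p q
      zone-unique (inside p) (other q _) = contradiction p q
      zone-unique (left q _) (inside p) = contradiction p q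
      zone-unique (left _ _) (left _ _) = refl
      zone-unique (left _ p) (other _ q) = contradiction p q
      zone-unique (other q _) (inside p) = contradiction p q
      zone-unique (other _ q) (left _ p) = contradiction p q
      zone-unique (other _ _) (other _ _) = refl

      w : Fin n → Fin n → ℤ
      w x y = turn (zone x) (zone y)

      w-zones : ∀ {x y a b} → InZone x a → InZone y b → w x y ≡ turn a b
      w-zones {x} {y} p q = cong₂ turn (zone-unique (proj₂ (zoned x)) p) (zone-unique (proj₂ (zoned y)) q)

      no-corner : ∀ {x r s} → N x → ¬ N r → hi r < lo o → ¬ N s → ¬ (hi s < lo o) → D x r → ¬ D x s
      no-corner Nx ¬Nr rl ¬Ns ¬sl xr xs with right-or-left Nx ¬Ns xs
      ... | inj₁ sr = not-both Nx ¬Nr xr rl xs sr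
      ... | inj₂ sl = ¬sl sl

      -- Both sides evaluate to the same number unless the three zones are distinct; then the vertex
      -- in `N` has outside neighbours on the left and elsewhere, which `no-corner` excludes.
      cocycle : ∀ {x y z} → D x y → D y z → D x z → w x y ⊕ w y z ≡ w x z
      cocycle {x} {y} {z} xy yz xz with zoned x | zoned y | zoned z
      ... | _ , inside _ | _ , inside _ | _ , inside _ = refl
      ... | _ , inside _ | _ , inside _ | _ , left _ _ = refl
      ... | _ , inside _ | _ , inside _ | _ , other _ _ = refl
      ... | _ , inside _ | _ , left _ _ | _ , inside _ = refl
      ... | _ , inside _ | _ , left _ _ | _ , left _ _ = refl
      ... | _ , inside i | _ , left a b | _ , other c d = contradiction xz (no-corner i a b c d xy)
      ... | _ , inside _ | _ , other _ _ | _ , inside _ = refl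
      ... | _ , inside i | _ , other c d | _ , left a b = contradiction xy (no-corner i a b c d xz)
      ... | _ , inside _ | _ , other _ _ | _ , other _ _ = refl
      ... | _ , left _ _ | _ , inside _ | _ , inside _ = refl
      ... | _ , left _ _ | _ , inside _ | _ , left _ _ = refl
      ... | _ , left a b | _ , inside i | _ , other c d = contradiction yz (no-corner i a b c d (D-sym xy))
      ... | _ , left _ _ | _ , left _ _ | _ , inside _ = refl
      ... | _ , left _ _ | _ , left _ _ | _ , left _ _ = refl
      ... | _ , left _ _ | _ , left _ _ | _ , other _ _ = refl
      ... | _ , left a b | _ , other c d | _ , inside i = contradiction (D-sym yz) (no-corner i a b c d (D-sym xz))
      ... | _ , left _ _ | _ , other _ _ | _ , left _ _ = refl
      ... | _ , left _ _ | _ , other _ _ | _ , other _ _ = refl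
      ... | _ , other _ _ | _ , inside _ | _ , inside _ = refl
      ... | _ , other c d | _ , inside i | _ , left a b = contradiction (D-sym xy) (no-corner i a b c d yz)
      ... | _ , other _ _ | _ , inside _ | _ , other _ _ = refl
      ... | _ , other c d | _ , left a b | _ , inside i = contradiction (D-sym xz) (no-corner i a b c d (D-sym yz))
      ... | _ , other _ _ | _ , left _ _ | _ , left _ _ = refl
      ... | _ , other _ _ | _ , left _ _ | _ , other _ _ = refl
      ... | _ , other _ _ | _ , other _ _ | _ , inside _ = refl
      ... | _ , other _ _ | _ , other _ _ | _ , left _ _ = refl
      ... | _ , other _ _ | _ , other _ _ | _ , other _ _ = refl

      w-out : ∀ {x y} → ¬ N x → ¬ N y → w x y ≡ 0ℤ
      w-out {x} {y} ¬Nx ¬Ny with zoned x | zoned y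
      ... | _ , inside Nx | _ = contradiction Nx ¬Nx
      ... | _ , left _ _ | _ , inside Ny = contradiction Ny ¬Ny
      ... | _ , left _ _ | _ , left _ _ = refl
      ... | _ , left _ _ | _ , other _ _ = refl
      ... | _ , other _ _ | _ = refl

      w-ascent : ∀ {x y} → 0ℤ ⊕ w x y ≡ 1ℤ → ¬ N x × N y × hi x < lo o
      w-ascent {x} {y} e with zoned x | zoned y
      w-ascent () | _ , inside _ | _ , inside _
      w-ascent () | _ , inside _ | _ , left _ _
      w-ascent () | _ , inside _ | _ , other _ _
      w-ascent _ | _ , left a b | _ , inside c = a , c , b
      w-ascent () | _ , left _ _ | _ , left _ _
      w-ascent () | _ , left _ _ | _ , other _ _
      w-ascent () | _ , other _ _ | _ , _

    open Closed w cocycle public using (w-self; closed-sum)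

    w-anti : ∀ {x y} → D x y → w x y ⊕ w y x ≡ 0ℤ
    w-anti {x} d = trans (cocycle d (D-sym d) (D-refl x)) (w-self x)

    -- Two sheets of the infinite cyclic cover that w defines.
    record D″ (u v : Fin n × Bool) : Set where
      constructor _,_
      field
        base  : D (proj₁ u) (proj₁ v)
        level : lv (proj₂ u) ⊕ w (proj₁ u) (proj₁ v) ≡ lv (proj₂ v)

    open D″

    D″? : ∀ u v → Dec (D″ u v)
    D″? (x , i) (y , j) = map′ (λ (d , e) → d , e) (λ (d , e) → d , e)
                            (D? x y ×-dec (lv i ⊕ w x y ℤ.≟ lv j))

    D″-refl : ∀ u → D″ u u
    D″-refl (x , i) = D-refl x , trans (cong (lv i ⊕_) (w-self x)) (ℤ.+-identityʳ (lv i))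

    D″-sym : ∀ {u v} → D″ u v → D″ v u
    D″-sym {x , i} {y , j} (d , e) = D-sym d , (begin
      lv j ⊕ w y x            ≡⟨ cong (_⊕ w y x) (sym e) ⟩
      lv i ⊕ w x y ⊕ w y x    ≡⟨ ℤ.+-assoc (lv i) (w x y) (w y x) ⟩
      lv i ⊕ (w x y ⊕ w y x)  ≡⟨ cong (lv i ⊕_) (w-anti d) ⟩
      lv i ⊕ 0ℤ               ≡⟨ ℤ.+-identityʳ (lv i) ⟩
      lv i ∎)
      where open ≡-Reasoning

    -- Closed walks of length four have no winding, so balls lift to the cover.
    localRep″ : ∀ u → Local.LocalRep D″ u
    localRep″ (h , i) = record
      { lo = λ u → lo′ (proj₁ u)
      ; hi = λ u → hi′ (proj₁ u)
      ; top = R.top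
      ; valid = λ ((x , _) , (a , _) , (b , _)) → R.valid (x , a , b)
      ; touch = λ (a , _) ((x , _) , (b , _) , (c , _)) (d , _) → R.touch a (x , b , c) d
      ; meet = meet″
      }
      where
      module R = LocalRep (localRep h)
      open R using () renaming (lo to lo′; hi to hi′)
      meet″ : ∀ {u v} → D″ (h , i) u → Local.Near D″ (h , i) v →
              lo′ (proj₁ u) ≤ hi′ (proj₁ v) → lo′ (proj₁ v) ≤ hi′ (proj₁ u) → D″ u v
      meet″ {x , a} {y , b} (hx , e₁) ((m , c) , hm@(hm₀ , _) , my@(my₀ , _)) p q =
        xy , ∙-cancelʳ (w y m) _ _ (∙-cancelʳ (w m h) _ _ (begin
          lv a ⊕ w x y ⊕ w y m ⊕ w m h
            ≡⟨ cong (λ t → t ⊕ w x y ⊕ w y m ⊕ w m h) (sym e₁) ⟩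
          lv i ⊕ w h x ⊕ w x y ⊕ w y m ⊕ w m h
            ≡⟨ regroup (lv i) (w h x) (w x y) (w y m) (w m h) ⟩
          lv i ⊕ (0ℤ ⊕ w h x ⊕ w x y ⊕ w y m ⊕ w m h)
            ≡⟨ cong (lv i ⊕_) (closed-sum
                 (snoc (snoc (snoc (snoc nil hx) xy) (D-sym my₀)) (D-sym hm₀)) 4≤r) ⟩
          lv i ⊕ 0ℤ
            ≡⟨ ℤ.+-identityʳ (lv i) ⟩
          lv i
            ≡⟨ sym (level (D″-sym hm)) ⟩
          lv c ⊕ w m h
            ≡⟨ cong (_⊕ w m h) (sym (level (D″-sym my))) ⟩
          lv b ⊕ w y m ⊕ w m h ∎))
        where
        open ≡-Reasoning
        xy : D x y
        xy = R.meet hx (m , hm₀ , my₀) p q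
        regroup : ∀ l a b c d → l ⊕ a ⊕ b ⊕ c ⊕ d ≡ l ⊕ (0ℤ ⊕ a ⊕ b ⊕ c ⊕ d)
        regroup = ℤ-Solver.solve-∀

    w-in : ∀ {x y} → N x → N y → w x y ≡ 0ℤ
    w-in Nx Ny = w-zones (inside Nx) (inside Ny)

    w-left : ∀ {x r} → N x → ¬ N r → hi r < lo o → w r x ≡ 1ℤ
    w-left Nx ¬Nr l = w-zones (left ¬Nr l) (inside Nx)

    right-not-left : ∀ {x r} → N x → D x r → hi o < lo r → ¬ (hi r < lo o)
    right-not-left Nx d g l = <-irrefl refl (<-≤-trans l (≤-trans (proj₁ (valid (nearN (D-refl o))))
      (≤-trans (<⇒≤ g) (proj₁ (valid (near Nx d))))))

    w-right : ∀ {x r} → N x → ¬ N r → D x r → hi o < lo r → w r x ≡ 0ℤ × w x r ≡ 0ℤ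
    w-right Nx ¬Nr d g =
      w-zones (other ¬Nr nl) (inside Nx) , w-zones (inside Nx) (other ¬Nr nl)
      where nl = right-not-left Nx d g

    -- The clique at the start of `z`, the last point at which a neighbour of `o` begins; whatever
    -- passes the right end of `o` belongs to it.
    K₀ : Fin n → Set
    K₀ x = N x × lo z ≤ hi x

    -- On level 0 only the outside of `N` remains to be swept, on level 1 everything. A return to
    -- `N` from the left raises the level, so it shows as `(o , true)` being listed.
    K R : Fin n × Bool → Set
    K (x , i) = i ≡ false × K₀ x
    R (x , true) = ⊤
    R (x , false) = ¬ N x

    right⇒K₀ : ∀ {x} → N x → hi o < hi x → K₀ x
    right⇒K₀ Nx lt = Nx , ≤-trans (lo≤hi-o Nz) (<⇒≤ lt)

    lift₀ : ∀ {x y} i → D x y → w x y ≡ 0ℤ → D″ (x , i) (y , i)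
    lift₀ i d e = d , trans (cong (lv i ⊕_) e) (ℤ.+-identityʳ (lv i))

    zero-out-right : ∀ {x r} → N x → ¬ N r → D x r → w r x ≡ 0ℤ → hi o < lo r
    zero-out-right Nx ¬Nr d e with right-or-left Nx ¬Nr d
    ... | inj₁ g = g
    ... | inj₂ l with trans (sym (w-left Nx ¬Nr l)) e
    ...   | ()

    ascent : ∀ {x y} → D″ (x , false) (y , true) → ¬ N x × N y × hi x < lo o
    ascent d = w-ascent (level d)

    flat : ∀ {x y} i → D″ (x , i) (y , i) → w x y ≡ 0ℤ
    flat i (_ , e) = identityʳ-unique (lv i) _ e

    module S = Sweep (finBool n) D″ D″? D″-refl D″-sym localRep″

    state : S.State K R
    state = record
      { K? = λ { (x , i) → (i Bool.≟ false) ×-dec (N? x ×-dec lo z ≤? hi x) }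
      ; R? = λ { (x , true) → yes tt ; (x , false) → ¬? (N? x) }
      ; clique = λ { {x , _} {y , _} (refl , Nx , zx) (refl , Ny , zy) →
          lift₀ false (meet Nx (nearN Ny) (≤-trans (proj₂ (proj₂ z-arg) x Nx) zy)
                                          (≤-trans (proj₂ (proj₂ z-arg) y Ny) zx)) (w-in Nx Ny) }
      ; maximal = maximal
      ; R∩K = λ { {x , true} _ () ; {x , false} ¬Nx (_ , Nx , _) → ¬Nx Nx }
      ; closed = closed
      ; g = o , false
      ; ℓ = ℓ , false
      ; g∈K = Ko
      ; g-R = λ { {x , true} _ d → proj₁ (ascent d) (D-refl o) ; {x , false} ¬Nx (d , _) → ¬Nx d }
      ; ℓ-g = lift₀ false (D-sym Nℓ) (w-in Nℓ (D-refl o))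
      ; anchor = anchor
      }
      where
      Ko : K (o , false)
      Ko = refl , D-refl o , lo≤hi-o Nz
      maximal : ∀ {u} → (∀ {v} → K v → D″ v u) → K u
      maximal {x , true} f = contradiction (D-refl o) (proj₁ (ascent (f Ko)))
      maximal {x , false} f = refl , base (f Ko) ,
        proj₁ (touch Nz (nearN (base (f Ko)))
                 (base (f (refl , Nz , proj₁ (valid (nearN Nz))))))
      closed : ∀ {u v} → R u → D″ u v → K v ⊎ R v
      closed {v = y , true} _ _ = inj₂ tt
      closed {x , true} {y , false} _ d =
        inj₂ (proj₁ (ascent (D″-sym d)))
      closed {x , false} {y , false} ¬Nx d = by-side (N? y)
        where
        by-side : Dec (N y) → K (y , false) ⊎ ¬ N y
        by-side (no ¬Ny) = inj₂ ¬Ny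
        by-side (yes Ny) = inj₁ (refl , right⇒K₀ Ny (right⇒<hi Ny (D-sym (base d))
                             (zero-out-right Ny ¬Nx (D-sym (base d)) (flat false d))))
      anchor : ∀ {u v} → K u → R v → D″ u v → ¬ D″ u (ℓ , false)
      anchor {x , _} {y , true} (refl , Nx , _) _ d _ = proj₁ (ascent d) Nx
      anchor {x , _} {y , false} (refl , Nx , _) ¬Ny d (xℓ , _) =
        right-avoids-ℓ Nx ¬Ny (base d)
          (zero-out-right Nx ¬Ny (base d) (flat false (D″-sym d))) xℓ

    module FromSweep (J : Swept D″ K R) where
      open Swept J renaming
        (S to S″; lo to loJ; hi to hiJ; touch to touchJ; meet to meetJ; S-closed to S″-closed)

      Ko : ∀ {x} → K₀ x → K (x , false)
      Ko k = refl , k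

      apartJ : ∀ {u v} → K u ⊎ S″ u → K v ⊎ S″ v → ¬ D″ u v → hiJ u < loJ v ⊎ hiJ v < loJ u
      apartJ {u} {v} cu cv ¬d with loJ u ≤? hiJ v | loJ v ≤? hiJ u
      ... | yes p | yes q = contradiction (meetJ cu cv p q) ¬d
      ... | no p | _ = inj₂ (≰⇒> p)
      ... | yes _ | no q = inj₁ (≰⇒> q)

      ordered : ∀ {u} → K u ⊎ S″ u → loJ u ≤ hiJ u
      ordered {u} c = touchJ c c (D″-refl u)

      module Cyclic (So : S″ (o , true)) where

        N⇒S : ∀ {x} → N x → S″ (x , true)
        N⇒S Nx with S″-closed So (lift₀ true Nx (w-in (D-refl o) Nx))
        ... | inj₁ ()
        ... | inj₂ s = s

        -- By connectedness, along a walk to `o`. Where the walk enters `N`, a right attachment is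
        -- listed because of `K`, and a left one because it is adjacent to the copy of `N` on level
        -- 1.
        out⇒S : ∀ {k x} → ¬ N x → Walk G x o k → S″ (x , false)
        out⇒S ¬No here = contradiction (D-refl o) ¬No
        out⇒S {x = x} ¬Nx (step {y = y} e p) with N? y
        ... | no ¬Ny with S″-closed (out⇒S ¬Ny p) (lift₀ false (D-sym (inj₂ e)) (w-out ¬Ny ¬Nx))
        ...   | inj₁ (_ , Nx , _) = contradiction Nx ¬Nx
        ...   | inj₂ s = s
        out⇒S {x = x} ¬Nx (step {y = y} e p) | yes Ny with right-or-left Ny ¬Nx (D-sym (inj₂ e))
        ...   | inj₁ g = K-S (Ko (right⇒K₀ Ny (right⇒<hi Ny (D-sym (inj₂ e)) g))) ¬Nx
                           (lift₀ false (D-sym (inj₂ e)) (proj₂ (w-right Ny ¬Nx (D-sym (inj₂ e)) g)))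
        ...   | inj₂ l with S″-closed (N⇒S Ny) (D″-sym (inj₂ e , trans (ℤ.+-identityˡ _) (w-left Ny ¬Nx l)))
        ...     | inj₁ (_ , Nx , _) = contradiction Nx ¬Nx
        ...     | inj₂ s = s

        S-out : ∀ {x} → ¬ N x → S″ (x , false)
        S-out {x} ¬Nx = out⇒S ¬Nx (proj₂ (conn x o))

        loO hiO : ℕ
        loO = loJ (o , true)
        hiO = hiJ (o , true)

        -- Outside vertices listed after the second copy of `o`. They have to be excluded before the
        -- positions up to `loO` can serve as the layout of the whole rest.
        Right : Fin n → Set
        Right x = ¬ N x × hiO < loJ (x , false)

        not-o : ∀ {x} → ¬ N x → ∀ i → ¬ D″ (o , true) (x , i)
        not-o ¬Nx i (d , _) = ¬Nx d

        K-before : ∀ {x} → K₀ x → hiJ (x , false) < loO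
        K-before {x} k with apartJ (inj₁ (Ko k)) (inj₂ So) (λ d → proj₁ (ascent d) (proj₁ k))
        ... | inj₁ lt = lt
        ... | inj₂ lt = contradiction (subst (hiO <_) (lo-K (Ko k)) lt) λ ()

        right-step : ∀ {x y j} → Right x → D″ (x , false) (y , j) →
                     (j ≡ true) ⊎ (j ≡ false × Right y)
        right-step {x} {y} {true} _ _ = inj₁ refl
        right-step {x} {y} {false} (¬Nx , gt) d with S″-closed (S-out ¬Nx) d
        ... | inj₁ k = contradiction (K-before (proj₂ k)) (≤⇒≯ (≤-trans (ordered (inj₂ So))
                         (≤-trans (<⇒≤ gt) (touchJ (inj₂ (S-out ¬Nx)) (inj₁ k) d))))
        ... | inj₂ s with S⊆R s
        ...   | ¬Ny with apartJ (inj₂ So) (inj₂ s) (not-o ¬Ny false)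
        ...     | inj₁ lt = inj₂ (refl , ¬Ny , lt)
        ...     | inj₂ lt = contradiction lt (≤⇒≯ (≤-trans (ordered (inj₂ So))
                         (≤-trans (<⇒≤ gt) (touchJ (inj₂ (S-out ¬Nx)) (inj₂ s) d))))

        Right? : ∀ x → Dec (Right x)
        Right? x = ¬? (N? x) ×-dec (hiO <? loJ (x , false))

        Beyond : Fin n × Bool → Set
        Beyond (x , true) = S″ (x , true)
        Beyond (x , false) = Right x

        Beyond? : ∀ u → Dec (Beyond u)
        Beyond? (x , true) = S? (x , true)
        Beyond? (x , false) = Right? x

        RightOnly : Fin n × Bool → Set
        RightOnly (x , true) = ⊥
        RightOnly (x , false) = Right x

        RightOnly? : ∀ u → Dec (RightOnly u)
        RightOnly? (x , true) = no λ ()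
        RightOnly? (x , false) = Right? x

        K∩Beyond : ∀ {u} → K u → ¬ Beyond u
        K∩Beyond {x , _} (refl , Nx , _) (¬Nx , _) = ¬Nx Nx

        K∩RightOnly : ∀ {u} → K u → ¬ RightOnly u
        K∩RightOnly {x , _} (refl , Nx , _) (¬Nx , _) = ¬Nx Nx

        -- A chain from `(o , true)` back to `K` must leave level 1 and the part beyond `o`. It can
        -- do so only from some `(x , true)` to an outside vertex listed before `o`, so `x` starts
        -- before `o` too.
        entry : ∃[ x ] ∃[ r ] (N x × ¬ N r × D x r × hi r < lo o × loJ (x , true) < loO)
        entry with exit Beyond? K∩Beyond So (reach So)
        ... | (x , true) , (y , true) , sx , ¬sy , d with S″-closed sx d
        ...   | inj₁ ()
        ...   | inj₂ sy = contradiction sy ¬sy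
        entry | (x , true) , (y , false) , sx , ¬by , d with ascent (D″-sym d)
        ...   | ¬Ny , Nx , l with apartJ (inj₂ So) (inj₂ (S-out ¬Ny)) (not-o ¬Ny false)
        ...     | inj₁ gt = contradiction (¬Ny , gt) ¬by
        ...     | inj₂ lt = x , y , Nx , ¬Ny , base d , l ,
                   ≤-<-trans (touchJ (inj₂ sx) (inj₂ (S-out ¬Ny)) d) lt
        entry | (x , false) , (y , j) , rx , ¬by , d with right-step rx d
        ...   | inj₂ (refl , ry) = contradiction ry ¬by
        ...   | inj₁ refl = contradiction (N⇒S (proj₁ (proj₂ (ascent d)))) ¬by

        -- Otherwise some left-attached `y` extends past the end of `o`, while `entry` gives a
        -- left-attached `x′` that starts before `o`. Both contain the left end of `o` in `ρ`, so
        -- they are adjacent, and their intervals in the sweep together cover that of `o`. No room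
        -- is left for `z`, which meets `o` but neither of the two.
        none-right : ∀ {x} → ¬ Right x
        none-right {x} rx with exit RightOnly? K∩RightOnly {x , false} rx (reach (S-out (proj₁ rx)))
        ... | (s , false) , (y , j) , rs , ¬ry , d with right-step rs d
        ...   | inj₂ (refl , ry) = ¬ry ry
        ...   | inj₁ refl with ascent d | entry
        ...     | ¬Ns , Ny , sl | x′ , r′ , Nx′ , ¬Nr′ , x′r′ , r′l , before =
          [ (λ y<z → <-irrefl refl (<-≤-trans y<z (≤-trans z≤o (≤-trans (<⇒≤ (proj₂ rs)) s≤y))))
          , (λ z<y → [ (λ x′<z → <-irrefl refl (<-≤-trans z<y (≤-trans y≤x′ (≤-trans (<⇒≤ x′<z) z≤z))))
                     , (λ z<x′ → <-irrefl refl (<-≤-trans (<-trans z<x′ before) o≤z)) ]′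
                     (apartJ (inj₂ (N⇒S Nx′)) (inj₂ (N⇒S Nz)) (λ xz → left-avoids-z Nx′ ¬Nr′ x′r′ r′l (base xz))))
          ]′ (apartJ (inj₂ (N⇒S Ny)) (inj₂ (N⇒S Nz)) (λ yz → left-avoids-z Ny ¬Ns (D-sym (base d)) sl (base yz)))
          where
          oz : D″ (o , true) (z , true)
          oz = lift₀ true Nz (w-in (D-refl o) Nz)
          z≤o : loJ (z , true) ≤ hiO
          z≤o = touchJ (inj₂ (N⇒S Nz)) (inj₂ So) (D″-sym oz)
          o≤z : loO ≤ hiJ (z , true)
          o≤z = touchJ (inj₂ So) (inj₂ (N⇒S Nz)) oz
          z≤z : loJ (z , true) ≤ hiJ (z , true)
          z≤z = ordered (inj₂ (N⇒S Nz))
          s≤y : loJ (s , false) ≤ hiJ (y , true)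
          s≤y = touchJ (inj₂ (S-out ¬Ns)) (inj₂ (N⇒S Ny)) d
          yx′ : D y x′
          yx′ = meet Ny (nearN Nx′) (≤-trans (<⇒≤ (left⇒lo< Ny (D-sym (base d)) sl)) (lo-o≤hi Nx′))
                  (≤-trans (<⇒≤ (left⇒lo< Nx′ x′r′ r′l)) (lo-o≤hi Ny))
          y≤x′ : loJ (y , true) ≤ hiJ (x′ , true)
          y≤x′ = touchJ (inj₂ (N⇒S Ny)) (inj₂ (N⇒S Nx′)) (lift₀ true yx′ (w-in Ny Nx′))

        before-o : ∀ {r} → ¬ N r → hiJ (r , false) < loO
        before-o ¬Nr with apartJ (inj₂ So) (inj₂ (S-out ¬Nr)) (not-o ¬Nr false)
        ... | inj₁ gt = contradiction (¬Nr , gt) none-right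
        ... | inj₂ lt = lt

        twoEnd : TwoEnd ρ
        twoEnd = record
          { P = loO
          ; lo₂ = λ r → loJ (r , false)
          ; hi₂ = λ r → hiJ (r , false)
          ; re = λ x → hiJ (x , false)
          -- The cap keeps `le x` within the layout; it adds no contact, since every outside vertex
          -- ends strictly before `loO`.
          ; le = λ x → loO ⊓ loJ (x , true)
          ; lo≤hi = λ ¬Nr → ordered (inj₂ (S-out ¬Nr))
          ; hi≤P = λ ¬Nr → <⇒≤ (before-o ¬Nr)
          ; re≤P = λ Nx lt → <⇒≤ (K-before (right⇒K₀ Nx lt))
          ; le≤P = λ _ → m⊓n≤m loO _
          ; out-touch = λ ¬Nr ¬Ns d → touchJ (inj₂ (S-out ¬Nr)) (inj₂ (S-out ¬Ns)) (lift₀ false d (w-out ¬Nr ¬Ns))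
          ; out-meet = λ ¬Nr ¬Ns p q → base (meetJ (inj₂ (S-out ¬Nr)) (inj₂ (S-out ¬Ns)) p q)
          ; right-touch = λ Nx ¬Nr d g → touchJ (inj₂ (S-out ¬Nr)) (inj₁ (Ko (right⇒K₀ Nx (right⇒<hi Nx d g))))
              (lift₀ false (D-sym d) (proj₁ (w-right Nx ¬Nr d g)))
          ; right-meet = right-meet
          ; left-touch = λ Nx ¬Nr d l → ≤-trans (m⊓n≤n loO _) (touchJ (inj₂ (N⇒S Nx)) (inj₂ (S-out ¬Nr))
              (D″-sym (D-sym d , trans (ℤ.+-identityˡ _) (w-left Nx ¬Nr l))))
          ; left-meet = left-meet
          ; cross = cross
          }
          where
          right-meet : ∀ {x r} → N x → ¬ N r → hi o < hi x → loJ (r , false) ≤ hiJ (x , false) → D x r × hi o < lo r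
          right-meet {x} {r} Nx ¬Nr lt p = base d , zero-out-right Nx ¬Nr (base d) (flat false (D″-sym d))
            where
            k = Ko (right⇒K₀ Nx lt)
            d : D″ (x , false) (r , false)
            d = meetJ (inj₁ k) (inj₂ (S-out ¬Nr)) (subst (_≤ hiJ (r , false)) (sym (lo-K k)) z≤n) p
          left-meet : ∀ {x r} → N x → ¬ N r → lo x < lo o → loO ⊓ loJ (x , true) ≤ hiJ (r , false) → D x r × hi r < lo o
          left-meet {x} {r} Nx ¬Nr _ p = base d , proj₂ (proj₂ (ascent (D″-sym d)))
            where
            lox≤ : loJ (x , true) ≤ hiJ (r , false)
            lox≤ with ≤-total loO (loJ (x , true))
            ... | inj₁ le = contradiction (before-o ¬Nr) (≤⇒≯ (subst (_≤ hiJ (r , false)) (m≤n⇒m⊓n≡m le) p))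
            ... | inj₂ ge = subst (_≤ hiJ (r , false)) (m≥n⇒m⊓n≡n ge) p
            d : D″ (x , true) (r , false)
            d = meetJ (inj₂ (N⇒S Nx)) (inj₂ (S-out ¬Nr)) lox≤
                  (≤-trans (ordered (inj₂ (S-out ¬Nr))) (≤-trans (<⇒≤ (before-o ¬Nr))
                    (touchJ (inj₂ So) (inj₂ (N⇒S Nx)) (lift₀ true Nx (w-in (D-refl o) Nx)))))
          cross : ∀ {x y} → N x → N y → hi o < hi x → lo y < lo o → hiJ (x , false) < loO ⊓ loJ (y , true)
          cross {x} {y} Nx Ny lt _ = ⊓-pres-m< (K-before (right⇒K₀ Nx lt)) x<y
            where
            k = Ko (right⇒K₀ Nx lt)
            x<y : hiJ (x , false) < loJ (y , true)
            x<y with apartJ (inj₁ k) (inj₂ (N⇒S Ny)) (λ d → proj₁ (ascent d) Nx)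
            ... | inj₁ lt = lt
            ... | inj₂ gt = contradiction (subst (hiJ (y , true) <_) (lo-K k) gt) λ ()

      module Linear (¬So : ¬ S″ (o , true)) where

        N⇒¬S : ∀ {x} → N x → ¬ S″ (x , true)
        N⇒¬S {x} Nx s with S″-closed s (lift₀ true (D-sym Nx) (w-in Nx (D-refl o)))
        ... | inj₁ ()
        ... | inj₂ so = ¬So so

        -- A left attachment would have led the sweep to `(x , true)`, and from there to
        -- `(o , true)`.
        S-right : ∀ {x r} → N x → S″ (r , false) → D x r → hi o < lo r
        S-right {x} {r} Nx s d with right-or-left Nx (S⊆R s) d
        ... | inj₁ g = g
        ... | inj₂ l with S″-closed {y = x , true} s (D-sym d , trans (ℤ.+-identityˡ _) (w-left Nx (S⊆R s) l))
        ...   | inj₁ ()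
        ...   | inj₂ sx = contradiction sx (N⇒¬S Nx)

        lift-right : ∀ {x r} → N x → S″ (r , false) → D x r → D″ (r , false) (x , false)
        lift-right Nx s d = lift₀ false (D-sym d) (proj₁ (w-right Nx (S⊆R s) d (S-right Nx s d)))

        top-arg : ∃[ u ] (⊤ × (∀ v → ⊤ → hiJ v ≤ hiJ u))
        top-arg = FiniteSearch.argmax (finBool n) (λ _ → yes tt) hiJ ((o , true) , tt)

        oneEnd : OneEnd ρ
        oneEnd = record
          { S = λ x → S″ (x , false)
          ; S? = λ x → S? (x , false)
          ; S-out = S⊆R
          ; S-closed = λ s d ¬Ny → [ (λ (_ , Ny , _) → contradiction Ny ¬Ny) , (λ s′ → s′) ]′
              (S″-closed s (lift₀ false d (w-out (S⊆R s) ¬Ny)))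
          ; right-S = λ Nx ¬Nr d g → K-S (Ko (right⇒K₀ Nx (right⇒<hi Nx d g))) ¬Nr
              (lift₀ false d (proj₂ (w-right Nx ¬Nr d g)))
          ; S-right = S-right
          ; lo₁ = λ r → loJ (r , false)
          ; hi₁ = λ r → hiJ (r , false)
          ; re₁ = λ x → hiJ (x , false)
          ; bound = hiJ (proj₁ top-arg)
          ; hi₁≤bound = λ x → proj₂ (proj₂ top-arg) (x , false) tt
          ; re₁≤bound = λ x → proj₂ (proj₂ top-arg) (x , false) tt
          ; touch₁ = λ sr ss d → touchJ (inj₂ sr) (inj₂ ss) (lift₀ false d (w-out (S⊆R sr) (S⊆R ss)))
          ; meet₁ = λ sr ss p q → base (meetJ (inj₂ sr) (inj₂ ss) p q)
          ; right-touch = λ Nx s d → touchJ (inj₂ s)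
              (inj₁ (Ko (right⇒K₀ Nx (right⇒<hi Nx d (S-right Nx s d))))) (lift-right Nx s d)
          ; right-meet = λ Nx s lt p → let k = Ko (right⇒K₀ Nx lt) in
              base (meetJ (inj₁ k) (inj₂ s) (subst (_≤ hiJ _) (sym (lo-K k)) z≤n) p)
          }

      result : TwoEnd ρ ⊎ OneEnd ρ
      result with S? (o , true)
      ... | yes So = inj₁ (Cyclic.twoEnd So)
      ... | no ¬So = inj₂ (Linear.oneEnd ¬So)

    oneSide : TwoEnd ρ ⊎ OneEnd ρ
    oneSide = FromSweep.result (S.sweep state)

-- Circular-arc representations

m∸n≤o⇒m≤n+o : ∀ m n {o} → m ∸ n ≤ o → m ≤ n + o
m∸n≤o⇒m≤n+o m n le = ≤-trans (m≤n+m∸n m n) (+-monoʳ-≤ n le)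

module Offset (k : ℕ) where

  M : ℕ
  M = 3 + k

  offset-≥ : ∀ s j → toℕ s ≤ toℕ j → offset k s j ≡ toℕ j ∸ toℕ s
  offset-≥ s j s≤j = begin
    (toℕ j + (M ∸ toℕ s)) % M  ≡⟨ cong (_% M) (sym (+-∸-assoc (toℕ j) (<⇒≤ (Fin.toℕ<n s)))) ⟩
    (toℕ j + M ∸ toℕ s) % M    ≡⟨ cong (_% M) (+-∸-comm M s≤j) ⟩
    (toℕ j ∸ toℕ s + M) % M    ≡⟨ [m+n]%n≡m%n (toℕ j ∸ toℕ s) M ⟩
    (toℕ j ∸ toℕ s) % M        ≡⟨ m<n⇒m%n≡m (≤-<-trans (m∸n≤m (toℕ j) (toℕ s)) (Fin.toℕ<n j)) ⟩
    toℕ j ∸ toℕ s ∎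
    where open ≡-Reasoning

  offset-< : ∀ s j → toℕ j < toℕ s → offset k s j ≡ toℕ j + M ∸ toℕ s
  offset-< s j j<s = begin
    (toℕ j + (M ∸ toℕ s)) % M  ≡⟨ cong (_% M) assoc ⟩
    (toℕ j + M ∸ toℕ s) % M    ≡⟨ m<n⇒m%n≡m (m<n+o⇒m∸n<o (toℕ j + M) (toℕ s) (+-monoˡ-< M j<s)) ⟩
    toℕ j + M ∸ toℕ s ∎
    where
    open ≡-Reasoning
    assoc = sym (+-∸-assoc (toℕ j) (<⇒≤ (Fin.toℕ<n s)))

  -- An arc becomes an interval of the line with `s < M` and `e < s + M`, in which a point `j` of
  -- the cycle can appear only as `j` or as `j + M`.
  Covers : ℕ → ℕ → ℕ → Set
  Covers s e j = (s ≤ j × j ≤ e) ⊎ (j + M ≤ e)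

  module _ (s : Fin M) (l : ℕ) (j : Fin M) where

    offset⇒ : offset k s j ≤ l → Covers (toℕ s) (toℕ s + l) (toℕ j)
    offset⇒ p with toℕ s ≤? toℕ j
    ... | yes s≤j = inj₁ (s≤j , m∸n≤o⇒m≤n+o (toℕ j) (toℕ s) (subst (_≤ l) (offset-≥ s j s≤j) p))
    ... | no s≰j = inj₂ (m∸n≤o⇒m≤n+o _ (toℕ s) (subst (_≤ l) (offset-< s j (≰⇒> s≰j)) p))

    offset⇐ : l < M → Covers (toℕ s) (toℕ s + l) (toℕ j) → offset k s j ≤ l
    offset⇐ l<M (inj₁ (s≤j , j≤e)) =
      subst (_≤ l) (sym (offset-≥ s j s≤j)) (m≤n+o⇒m∸n≤o (toℕ j) (toℕ s) j≤e)
    offset⇐ l<M (inj₂ j≤e) =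
      subst (_≤ l) (sym (offset-< s j j<s)) (m≤n+o⇒m∸n≤o _ (toℕ s) j≤e)
      where
      j<s : toℕ j < toℕ s
      j<s = +-cancelʳ-< M _ _ (≤-<-trans j≤e (+-monoʳ-< (toℕ s) l<M))

  CoversEdge : ℕ → ℕ → ℕ → Set
  CoversEdge s e j = (s ≤ j × j < e) ⊎ (j + M < e)

  module _ (s : Fin M) (l : ℕ) (j : Fin M) where

    offset<⇒ : offset k s j < l → CoversEdge (toℕ s) (toℕ s + l) (toℕ j)
    offset<⇒ (s≤s {n = l′} p) with offset⇒ s l′ j p
    ... | inj₁ (a , b) = inj₁ (a , subst (toℕ j <_) (sym (+-suc (toℕ s) l′)) (s≤s b))
    ... | inj₂ b = inj₂ (subst (toℕ j + M <_) (sym (+-suc (toℕ s) l′)) (s≤s b))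

    offset<⇐ : l < M → CoversEdge (toℕ s) (toℕ s + l) (toℕ j) → offset k s j < l
    offset<⇐ l<M c = go l refl c
      where
      go : ∀ l′ → l′ ≡ l → CoversEdge (toℕ s) (toℕ s + l) (toℕ j) → offset k s j < l
      go zero refl (inj₁ (a , b)) = contradiction (subst (toℕ j <_) (+-identityʳ _) b) (≤⇒≯ a)
      go zero refl (inj₂ b) = contradiction (<-trans (≤-<-trans (m≤n+m M (toℕ j)) (subst (toℕ j + M <_) (+-identityʳ _) b)) (Fin.toℕ<n s)) (<-irrefl refl)
      go (suc l′) refl (inj₁ (a , b)) = s≤s (offset⇐ s l′ j (<⇒≤ l<M) (inj₁ (a , ≤-pred (subst (toℕ j <_) (+-suc (toℕ s) l′) b))))
      go (suc l′) refl (inj₂ b) = s≤s (offset⇐ s l′ j (<⇒≤ l<M) (inj₂ (≤-pred (subst (toℕ j + M <_) (+-suc (toℕ s) l′) b))))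

  Share : ℕ → ℕ → ℕ → ℕ → Set
  Share s e s′ e′ = (s ≤ e′ × s′ ≤ e) ⊎ (s + M ≤ e′) ⊎ (s′ + M ≤ e)

  Share-cong : ∀ {s s₁ e e₁ s′ s′₁ e′ e′₁} → s ≡ s₁ → e ≡ e₁ → s′ ≡ s′₁ → e′ ≡ e′₁ →
               Share s e s′ e′ → Share s₁ e₁ s′₁ e′₁
  Share-cong refl refl refl refl sh = sh

  common⇒share : ∀ {s e s′ e′ j} → s < M → s′ < M → Covers s e j → Covers s′ e′ j → Share s e s′ e′
  common⇒share _ _ (inj₁ (a , b)) (inj₁ (c , d)) = inj₁ (≤-trans a d , ≤-trans c b)
  common⇒share _ _ (inj₁ (a , b)) (inj₂ d) = inj₂ (inj₁ (≤-trans (+-monoˡ-≤ M a) d))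
  common⇒share _ _ (inj₂ b) (inj₁ (c , d)) = inj₂ (inj₂ (≤-trans (+-monoˡ-≤ M c) b))
  -- Both arcs pass the end of the cycle, so both intervals contain the position `M`.
  common⇒share {j = j} s< s′< (inj₂ b) (inj₂ d) =
    inj₁ (≤-trans (<⇒≤ s<) (≤-trans (m≤n+m M j) d) , ≤-trans (<⇒≤ s′<) (≤-trans (m≤n+m M j) b))

  -- The arc that starts later on the line, turns included, supplies the common point: its start.
  share⇒common : ∀ (s s′ : Fin M) {e e′} → toℕ s ≤ e → toℕ s′ ≤ e′ → Share (toℕ s) e (toℕ s′) e′ →
                 ∃[ j ] (Covers (toℕ s) e (toℕ j) × Covers (toℕ s′) e′ (toℕ j))
  share⇒common s s′ s≤e s′≤e′ (inj₁ (a , b)) with ≤-total (toℕ s) (toℕ s′)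
  ... | inj₁ le = s′ , inj₁ (le , b) , inj₁ (≤-refl , s′≤e′)
  ... | inj₂ ge = s , inj₁ (≤-refl , s≤e) , inj₁ (ge , a)
  share⇒common s s′ s≤e s′≤e′ (inj₂ (inj₁ a)) = s , inj₁ (≤-refl , s≤e) , inj₂ a
  share⇒common s s′ s≤e s′≤e′ (inj₂ (inj₂ a)) = s′ , inj₂ a , inj₁ (≤-refl , s′≤e′)

-- Subsets as lists

elements : ∀ {n} → Subset n → List (Fin n)
elements [] = []
elements (true ∷ p) = Fin.zero ∷ map Fin.suc (elements p)
elements (false ∷ p) = map Fin.suc (elements p)

length-elements : ∀ {n} (p : Subset n) → length (elements p) ≡ ∣ p ∣
length-elements [] = refl
length-elements (true ∷ p) = cong suc (trans (length-map Fin.suc (elements p)) (length-elements p))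
length-elements (false ∷ p) = trans (length-map Fin.suc (elements p)) (length-elements p)

∈-elements : ∀ {n} (p : Subset n) {x} → x ∈ₛ p → x ∈ elements p
∈-elements (true ∷ p) Vec.here = here refl
∈-elements (true ∷ p) (Vec.there i) = there (∈-map⁺ Fin.suc (∈-elements p i))
∈-elements (false ∷ p) (Vec.there i) = ∈-map⁺ Fin.suc (∈-elements p i)

delete : ∀ {A : Set} {z : A} {xs} → z ∈ xs →
         ∃[ ys ] (length xs ≡ suc (length ys) × (∀ {x} → x ∈ xs → x ≢ z → x ∈ ys))
delete {xs = _ ∷ xs} (here refl) = xs , refl , λ { (here e) ne → contradiction e ne ; (there i) _ → i }
delete {xs = x ∷ _} (there i) = let ys , len , keep = delete i in
  x ∷ ys , cong suc len , λ { (here e) _ → here e ; (there j) ne → there (keep j ne) }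

-- Closing up the circle

module Wrap {n : ℕ} (G : Graph n) {r : ℕ} (conn : Connected G) (4≤r : 4 ≤ r)
            (int : LocallyInterval r G) (o : Fin n) where
  open Graphs G
  open LocallyIntervalGraph conn 4≤r int
  open Local D
  open FiniteSearch (finFin n)
  open Around G conn 4≤r int o

  module _ (o-max : ∀ x → count (D? x) elems ≤ count N? elems) (ρ : LocalRep o) where
    open Side o-max ρ
    open LocalRep ρ

    -- The right end takes the low positions, the left end is mirrored into the high ones, and the
    -- `suc` in `P` keeps them disjoint. By connectedness every outside vertex lies on one of the
    -- ends (`either`).
    joinEnds : OneEnd ρ → OneEnd (flip D-refl ρ) → TwoEnd ρ
    joinEnds A B = record
      { P = P
      ; lo₂ = lo₂
      ; hi₂ = hi₂
      ; re = E₁.re₁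
      ; le = λ x → P ∸ E₂.re₁ x
      ; lo≤hi = λ {r} ¬Nr → lo≤hi′ ¬Nr
      ; hi≤P = hi≤P′
      ; re≤P = λ {x} _ _ → ≤-trans (E₁.re₁≤bound x) a≤P
      ; le≤P = λ {x} _ → m∸n≤m P (E₂.re₁ x)
      ; out-touch = out-touch′
      ; out-meet = out-meet′
      ; right-touch = right-touch′
      ; right-meet = right-meet′
      ; left-touch = left-touch′
      ; left-meet = left-meet′
      ; cross = λ {x} {y} _ _ _ _ → ≤-<-trans (E₁.re₁≤bound x) (far (E₂.re₁≤bound y))
      }
      where
      module E₁ = OneEnd A
      module E₂ = OneEnd B
      P : ℕ
      P = suc (E₁.bound + E₂.bound)
      lo₂ hi₂ : Fin n → ℕ
      lo₂ r with E₁.S? r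
      ... | yes _ = E₁.lo₁ r
      ... | no _ = P ∸ E₂.hi₁ r
      hi₂ r with E₁.S? r
      ... | yes _ = E₁.hi₁ r
      ... | no _ = P ∸ E₂.lo₁ r

      a≤P : E₁.bound ≤ P
      a≤P = m≤n⇒m≤1+n (m≤m+n E₁.bound E₂.bound)

      far : ∀ {t} → t ≤ E₂.bound → E₁.bound < P ∸ t
      far {t} le = subst (_≤ P ∸ t) (m+n∸n≡m (suc E₁.bound) E₂.bound) (∸-monoʳ-≤ P le)

      lo-o≤top : lo o ≤ top
      lo-o≤top = let l , u = valid (nearN (D-refl o)) in ≤-trans l u

      mirror : ∀ {t} → t < lo o → top ∸ lo o < top ∸ t
      mirror lt = ∸-monoʳ-< lt lo-o≤top

      unmirror : ∀ {t} → top ∸ lo o < top ∸ t → t < lo o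
      unmirror = ∸-cancelʳ-<

      either : ∀ {k r} → ¬ N r → Walk G r o k → E₁.S r ⊎ E₂.S r
      either ¬No here = contradiction (D-refl o) ¬No
      either {r = r} ¬Nr (step {y = y} e p) with N? y
      ... | no ¬Ny = [ (λ s → inj₁ (E₁.S-closed s (D-sym (inj₂ e)) ¬Nr))
                     , (λ s → inj₂ (E₂.S-closed s (D-sym (inj₂ e)) ¬Nr)) ]′ (either ¬Ny p)
      ... | yes Ny = [ (λ g → inj₁ (E₁.right-S Ny ¬Nr (D-sym (inj₂ e)) g))
                     , (λ l → inj₂ (E₂.right-S Ny ¬Nr (D-sym (inj₂ e)) (mirror l))) ]′
                     (right-or-left Ny ¬Nr (D-sym (inj₂ e)))

      inB : ∀ {r} → ¬ N r → ¬ E₁.S r → E₂.S r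
      inB {r} ¬Nr ¬a = [ (λ a → contradiction a ¬a) , (λ b → b) ]′ (either ¬Nr (proj₂ (conn r o)))

      B-ordered : ∀ {r} → E₂.S r → E₂.lo₁ r ≤ E₂.hi₁ r
      B-ordered b = E₂.touch₁ b b (D-refl _)

      B-lo≤P : ∀ {r} → E₂.S r → E₂.lo₁ r ≤ P
      B-lo≤P {r} b = ≤-trans (B-ordered b) (≤-trans (E₂.hi₁≤bound r) (m≤n⇒m≤1+n (m≤n+m E₂.bound E₁.bound)))

      lo≤hi′ : ∀ {r} → ¬ N r → lo₂ r ≤ hi₂ r
      lo≤hi′ {r} ¬Nr with E₁.S? r
      ... | yes a = E₁.touch₁ a a (D-refl r)
      ... | no ¬a = ∸-monoʳ-≤ P (B-ordered (inB ¬Nr ¬a))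

      hi≤P′ : ∀ {r} → ¬ N r → hi₂ r ≤ P
      hi≤P′ {r} _ with E₁.S? r
      ... | yes _ = ≤-trans (E₁.hi₁≤bound r) a≤P
      ... | no _ = m∸n≤m P (E₂.lo₁ r)

      out-touch′ : ∀ {r s} → ¬ N r → ¬ N s → D r s → lo₂ r ≤ hi₂ s
      out-touch′ {r} {s} ¬Nr ¬Ns d with E₁.S? r | E₁.S? s
      ... | yes a | yes a′ = E₁.touch₁ a a′ d
      ... | yes a | no ¬a′ = contradiction (E₁.S-closed a d ¬Ns) ¬a′
      ... | no ¬a | yes a′ = contradiction (E₁.S-closed a′ (D-sym d) ¬Nr) ¬a
      ... | no ¬a | no ¬a′ = ∸-monoʳ-≤ P (E₂.touch₁ (inB ¬Ns ¬a′) (inB ¬Nr ¬a) (D-sym d))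

      too-far : ∀ {u t} → u ≤ E₁.bound → t ≤ E₂.bound → ¬ (P ∸ t ≤ u)
      too-far u≤ t≤ le = <⇒≱ (far t≤) (≤-trans le u≤)

      out-meet′ : ∀ {r s} → ¬ N r → ¬ N s → lo₂ r ≤ hi₂ s → lo₂ s ≤ hi₂ r → D r s
      out-meet′ {r} {s} ¬Nr ¬Ns p q with E₁.S? r | E₁.S? s
      ... | yes a | yes a′ = E₁.meet₁ a a′ p q
      ... | yes a | no ¬a′ = contradiction q (too-far (E₁.hi₁≤bound r) (E₂.hi₁≤bound s))
      ... | no ¬a | yes a′ = contradiction p (too-far (E₁.hi₁≤bound s) (E₂.hi₁≤bound r))
      ... | no ¬a | no ¬a′ = let b = inB ¬Nr ¬a ; b′ = inB ¬Ns ¬a′ in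
        E₂.meet₁ b b′ (∸-cancelʳ-≤ (B-lo≤P b) q) (∸-cancelʳ-≤ (B-lo≤P b′) p)

      right-touch′ : ∀ {x r} → N x → ¬ N r → D x r → hi o < lo r → lo₂ r ≤ E₁.re₁ x
      right-touch′ {x} {r} Nx ¬Nr d g with E₁.S? r
      ... | yes a = E₁.right-touch Nx a d
      ... | no ¬a = contradiction (E₁.right-S Nx ¬Nr d g) ¬a

      right-meet′ : ∀ {x r} → N x → ¬ N r → hi o < hi x → lo₂ r ≤ E₁.re₁ x → D x r × hi o < lo r
      right-meet′ {x} {r} Nx ¬Nr lt p with E₁.S? r
      ... | yes a = let d = E₁.right-meet Nx a lt p in d , E₁.S-right Nx a d
      ... | no ¬a = contradiction p (too-far (E₁.re₁≤bound x) (E₂.hi₁≤bound r))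

      left-touch′ : ∀ {x r} → N x → ¬ N r → D x r → hi r < lo o → P ∸ E₂.re₁ x ≤ hi₂ r
      left-touch′ {x} {r} Nx ¬Nr d l with E₁.S? r
      ... | yes a = contradiction l (right-not-left Nx d (E₁.S-right Nx a d))
      ... | no ¬a = ∸-monoʳ-≤ P (E₂.right-touch Nx (inB ¬Nr ¬a) d)

      left-meet′ : ∀ {x r} → N x → ¬ N r → lo x < lo o → P ∸ E₂.re₁ x ≤ hi₂ r → D x r × hi r < lo o
      left-meet′ {x} {r} Nx ¬Nr lt p with E₁.S? r
      ... | yes a = contradiction p (too-far (E₁.hi₁≤bound r) (E₂.re₁≤bound x))
      ... | no ¬a = let b = inB ¬Nr ¬a
                        d = E₂.right-meet Nx b (mirror lt) (∸-cancelʳ-≤ (B-lo≤P b) p)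
                    in d , unmirror (E₂.S-right Nx b d)

    -- The cycle lists the positions 0 … P of the rest of the graph, one spare
    -- position, and then the positions of the interval of o.
    module Circle (T : TwoEnd ρ) where
      open TwoEnd T

      λₒ μₒ k : ℕ
      λₒ = lo o
      μₒ = hi o
      -- `P + 1` positions for the rest, one spare and `μₒ ∸ λₒ + 1` for `o` make `3 + k`.
      k = P + (μₒ ∸ λₒ)

      open Offset k

      mid : ℕ → ℕ
      mid t = 2 + P + (t ∸ λₒ)

      sN eN s e : Fin n → ℕ
      sN x with lo x <? λₒ
      ... | yes _ = le x
      ... | no _ = mid (lo x)
      eN x with μₒ <? hi x
      ... | yes _ = M + re x
      ... | no _ = mid (hi x)
      s x with N? x
      ... | yes _ = sN x
      ... | no _ = lo₂ x
      e x with N? x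
      ... | yes _ = eN x
      ... | no _ = hi₂ x

      s-in : ∀ {x} → N x → s x ≡ sN x
      s-in {x} Nx with N? x
      ... | yes _ = refl
      ... | no ¬Nx = contradiction Nx ¬Nx

      s-out : ∀ {x} → ¬ N x → s x ≡ lo₂ x
      s-out {x} ¬Nx with N? x
      ... | yes Nx = contradiction Nx ¬Nx
      ... | no _ = refl

      e-in : ∀ {x} → N x → e x ≡ eN x
      e-in {x} Nx with N? x
      ... | yes _ = refl
      ... | no ¬Nx = contradiction Nx ¬Nx

      e-out : ∀ {x} → ¬ N x → e x ≡ hi₂ x
      e-out {x} ¬Nx with N? x
      ... | yes Nx = contradiction Nx ¬Nx
      ... | no _ = refl

      P<mid : ∀ t → P < mid t
      P<mid t = s≤s (m≤n⇒m≤1+n (m≤m+n P _))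

      P<M : P < M
      P<M = s≤s (m≤n⇒m≤1+n (m≤n⇒m≤1+n (m≤m+n P _)))

      mid<M : ∀ {t} → t ≤ μₒ → mid t < M
      mid<M le = s≤s (s≤s (s≤s (+-monoʳ-≤ P (∸-monoˡ-≤ λₒ le))))

      mid-mono : ∀ {t u} → t ≤ u → mid t ≤ mid u
      mid-mono le = +-monoʳ-≤ (2 + P) (∸-monoˡ-≤ λₒ le)

      mid-cancel : ∀ {t u} → λₒ ≤ u → mid t ≤ mid u → t ≤ u
      mid-cancel {t} {u} λ≤u le = subst (t ≤_) (m+[n∸m]≡n λ≤u)
        (m∸n≤o⇒m≤n+o t λₒ (+-cancelˡ-≤ (2 + P) _ _ le))

      sN<M : ∀ {x} → N x → sN x < M
      sN<M {x} Nx with lo x <? λₒ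
      ... | yes _ = ≤-<-trans (le≤P Nx) P<M
      ... | no _ = mid<M (lo≤hi-o Nx)

      P<eN : ∀ {x} → P < eN x
      P<eN {x} with μₒ <? hi x
      ... | yes _ = <-≤-trans P<M (m≤m+n M _)
      ... | no _ = P<mid (hi x)

      sN⇒left : ∀ {x t} → t ≤ P → sN x ≤ t → lo x < λₒ × le x ≤ t
      sN⇒left {x} t≤P p with lo x <? λₒ
      ... | yes l = l , p
      ... | no _ = contradiction (≤-trans p t≤P) (<⇒≱ (P<mid (lo x)))

      left⇒sN : ∀ {x} → lo x < λₒ → sN x ≡ le x
      left⇒sN {x} l with lo x <? λₒ
      ... | yes _ = refl
      ... | no ¬l = contradiction l ¬l

      right⇒eN : ∀ {x} → μₒ < hi x → eN x ≡ M + re x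
      right⇒eN {x} l with μₒ <? hi x
      ... | yes _ = refl
      ... | no ¬l = contradiction l ¬l

      eN⇒right : ∀ {x} → M ≤ eN x → μₒ < hi x
      eN⇒right {x} p with μₒ <? hi x
      ... | yes l = l
      ... | no ¬l = contradiction p (<⇒≱ (mid<M (≮⇒≥ ¬l)))

      NN-touch : ∀ {x y} → N x → N y → lo x ≤ hi y → sN x ≤ eN y
      NN-touch {x} {y} Nx Ny p with lo x <? λₒ
      ... | yes _ = ≤-trans (le≤P Nx) (<⇒≤ (P<eN {y}))
      ... | no _ with μₒ <? hi y
      ...   | yes _ = ≤-trans (<⇒≤ (mid<M (lo≤hi-o Nx))) (m≤m+n M _)
      ...   | no _ = mid-mono p

      NN-meet : ∀ {x y} → N x → N y → sN x ≤ eN y → lo x ≤ hi y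
      NN-meet {x} {y} Nx Ny p with lo x <? λₒ
      ... | yes l = ≤-trans (<⇒≤ l) (lo-o≤hi Ny)
      ... | no _ with μₒ <? hi y
      ...   | yes l = ≤-trans (lo≤hi-o Nx) (<⇒≤ l)
      ...   | no _ = mid-cancel (lo-o≤hi Ny) p

      eN<sN+M : ∀ {x} → N x → eN x < sN x + M
      eN<sN+M {x} Nx with μₒ <? hi x
      ... | no ¬l = <-≤-trans (mid<M (≮⇒≥ ¬l)) (m≤n+m M _)
      ... | yes l with lo x <? λₒ
      ...   | yes l′ = subst (M + re x <_) (+-comm M (le x)) (+-monoʳ-< M (cross Nx Nx l l′))
      ...   | no _ = subst (M + re x <_) (+-comm M (mid (lo x))) (+-monoʳ-< M (≤-<-trans (re≤P Nx l) (P<mid (lo x))))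

      s<M : ∀ x → s x < M
      s<M x with N? x
      ... | yes Nx = sN<M Nx
      ... | no ¬Nx = ≤-<-trans (≤-trans (lo≤hi ¬Nx) (hi≤P ¬Nx)) P<M

      s≤e : ∀ x → s x ≤ e x
      s≤e x with N? x
      ... | yes Nx = NN-touch Nx Nx (proj₁ (valid (nearN Nx)))
      ... | no ¬Nx = lo≤hi ¬Nx

      e<s+M : ∀ x → e x < s x + M
      e<s+M x with N? x
      ... | yes Nx = eN<sN+M Nx
      ... | no ¬Nx = <-≤-trans (≤-<-trans (hi≤P ¬Nx) P<M) (m≤n+m M _)

      e-right : ∀ {y} → M ≤ e y → N y × μₒ < hi y × e y ≡ M + re y
      e-right {y} p with N? y
      ... | yes Ny = Ny , eN⇒right p , right⇒eN (eN⇒right p)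
      ... | no ¬Ny = contradiction (hi≤P ¬Ny) (<⇒≱ (<-≤-trans P<M p))

      -- With the cycle cut before position 0, the rest is on level 0, and `N`, entered from the
      -- left, is on level 1.
      λN : Fin n → ℤ
      λN x with N? x
      ... | yes _ = 1ℤ
      ... | no _ = 0ℤ

      λN-in : ∀ {x} → N x → λN x ≡ 1ℤ
      λN-in {x} Nx with N? x
      ... | yes _ = refl
      ... | no ¬Nx = contradiction Nx ¬Nx

      λN-out : ∀ {x} → ¬ N x → λN x ≡ 0ℤ
      λN-out {x} ¬Nx with N? x
      ... | yes Nx = contradiction Nx ¬Nx
      ... | no _ = refl

      -- Arcs that meet without passing the end of the cycle lie on the same
      -- sheet, on which λN gives the levels.
      meet₀ : ∀ {x y} → s x ≤ e y → s y ≤ e x → D x y × λN x ⊕ w x y ≡ λN y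
      meet₀ {x} {y} p q = cases (N? x) (N? y)
        where
        levels : ∀ {a b c} → λN x ≡ a → w x y ≡ b → λN y ≡ c → a ⊕ b ≡ c → λN x ⊕ w x y ≡ λN y
        levels refl refl refl eq = eq
        cases : Dec (N x) → Dec (N y) → D x y × λN x ⊕ w x y ≡ λN y
        cases (yes Nx) (yes Ny) =
          meet Nx (nearN Ny) (NN-meet Nx Ny (subst₂ _≤_ (s-in Nx) (e-in Ny) p))
                             (NN-meet Ny Nx (subst₂ _≤_ (s-in Ny) (e-in Nx) q)) ,
          levels (λN-in Nx) (w-in Nx Ny) (λN-in Ny) refl
        cases (no ¬Nx) (no ¬Ny) =
          out-meet ¬Nx ¬Ny (subst₂ _≤_ (s-out ¬Nx) (e-out ¬Ny) p) (subst₂ _≤_ (s-out ¬Ny) (e-out ¬Nx) q) ,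
          levels (λN-out ¬Nx) (w-out ¬Nx ¬Ny) (λN-out ¬Ny) refl
        cases (yes Nx) (no ¬Ny) =
          let l , p′ = sN⇒left {x} (hi≤P ¬Ny) (subst₂ _≤_ (s-in Nx) (e-out ¬Ny) p)
              d , yl = left-meet Nx ¬Ny l p′
              w≡ = trans (cong (_⊕ w x y) (sym (w-left Nx ¬Ny yl))) (w-anti (D-sym d))
          in d , levels (λN-in Nx) refl (λN-out ¬Ny) w≡
        cases (no ¬Nx) (yes Ny) =
          let l , q′ = sN⇒left {y} (hi≤P ¬Nx) (subst₂ _≤_ (s-in Ny) (e-out ¬Nx) q)
              d , xl = left-meet Ny ¬Nx l q′
          in D-sym d , levels (λN-out ¬Nx) (w-left Ny ¬Nx xl) (λN-in Ny) refl

      -- Here `y` passes the end of the cycle and is regarded as its copy on level 0. `cross` rules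
      -- out that `x` lies in `N`, so `x` is attached on the right of `o`, where `w` vanishes.
      meet₁ : ∀ {x y} → s x + M ≤ e y → D y x × w y x ≡ λN x
      meet₁ {x} {y} p with e-right {y} (≤-trans (m≤n+m M (s x)) p)
      ... | Ny , right , ey = cases (N? x)
        where
        sx≤re : s x ≤ re y
        sx≤re = +-cancelˡ-≤ M _ _ (subst₂ _≤_ (+-comm (s x) M) ey p)
        cases : Dec (N x) → D y x × w y x ≡ λN x
        cases (no ¬Nx) =
          let d , g = right-meet Ny ¬Nx right (subst (_≤ re y) (s-out ¬Nx) sx≤re)
          in d , trans (proj₂ (w-right Ny ¬Nx d g)) (sym (λN-out ¬Nx))
        cases (yes Nx) =
          let l , le≤ = sN⇒left {x} (re≤P Ny right) (subst (_≤ re y) (s-in Nx) sx≤re)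
          in contradiction le≤ (<⇒≱ (cross Ny Nx right l))

      touch-in-out : ∀ {x y} → N x → ¬ N y → D x y → Share (s x) (e x) (s y) (e y)
      touch-in-out {x} {y} Nx ¬Ny d with right-or-left Nx ¬Ny d
      ... | inj₁ g = inj₂ (inj₂ (subst₂ _≤_
        (trans (+-comm M (lo₂ y)) (cong (_+ M) (sym (s-out ¬Ny))))
        (trans (sym (right⇒eN (right⇒<hi Nx d g))) (sym (e-in Nx)))
        (+-monoʳ-≤ M (right-touch Nx ¬Ny d g))))
      ... | inj₂ l = inj₁
        ( subst₂ _≤_ (trans (sym (left⇒sN (left⇒lo< Nx d l))) (sym (s-in Nx))) (sym (e-out ¬Ny))
            (left-touch Nx ¬Ny d l)
        , subst₂ _≤_ (sym (s-out ¬Ny)) (sym (e-in Nx))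
            (≤-trans (lo≤hi ¬Ny) (≤-trans (hi≤P ¬Ny) (<⇒≤ (P<eN {x})))))

      Share-sym : ∀ {s e s′ e′} → Share s e s′ e′ → Share s′ e′ s e
      Share-sym (inj₁ (a , b)) = inj₁ (b , a)
      Share-sym (inj₂ (inj₁ a)) = inj₂ (inj₂ a)
      Share-sym (inj₂ (inj₂ a)) = inj₂ (inj₁ a)

      share : ∀ {x y} → D x y → Share (s x) (e x) (s y) (e y)
      share {x} {y} d = cases (N? x) (N? y)
        where
        cases : Dec (N x) → Dec (N y) → Share (s x) (e x) (s y) (e y)
        cases (yes Nx) (yes Ny) = let p , q = touch Nx (nearN Ny) d in inj₁
          ( subst₂ _≤_ (sym (s-in Nx)) (sym (e-in Ny)) (NN-touch Nx Ny p)
          , subst₂ _≤_ (sym (s-in Ny)) (sym (e-in Nx)) (NN-touch Ny Nx q))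
        cases (no ¬Nx) (no ¬Ny) = inj₁
          ( subst₂ _≤_ (sym (s-out ¬Nx)) (sym (e-out ¬Ny)) (out-touch ¬Nx ¬Ny d)
          , subst₂ _≤_ (sym (s-out ¬Ny)) (sym (e-out ¬Nx)) (out-touch ¬Ny ¬Nx (D-sym d)))
        cases (yes Nx) (no ¬Ny) = touch-in-out Nx ¬Ny d
        cases (no ¬Nx) (yes Ny) = Share-sym {s y} {e y} (touch-in-out Ny ¬Nx (D-sym d))

      unshare : ∀ {x y} → Share (s x) (e x) (s y) (e y) → D x y
      unshare {x} {y} (inj₁ (p , q)) = proj₁ (meet₀ {x} {y} p q)
      unshare {x} {y} (inj₂ (inj₁ p)) = D-sym (proj₁ (meet₁ {x} {y} p))
      unshare {x} {y} (inj₂ (inj₂ p)) = proj₁ (meet₁ {y} {x} p)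

      start : Fin n → Fin M
      start x = fromℕ< (s<M x)

      len : Fin n → ℕ
      len x = e x ∸ s x

      len< : ∀ x → len x < M
      len< x = m<n+o⇒m∸n<o (e x) (s x) (e<s+M x)

      start≡ : ∀ x → toℕ (start x) ≡ s x
      start≡ x = Fin.toℕ-fromℕ< (s<M x)

      end≡ : ∀ x → toℕ (start x) + len x ≡ e x
      end≡ x = trans (cong (_+ len x) (start≡ x)) (m+[n∸m]≡n (s≤e x))

      caRep : CARep G
      caRep = record
        { k = k
        ; start = start
        ; len = len
        ; len< = len<
        ; repr = λ x y x≢y → mk⇔ (λ edge → to edge) (from x≢y)
        }
        where
        to : ∀ {x y} → Edge G x y → ∃[ j ] (offset k (start x) j ≤ len x × offset k (start y) j ≤ len y)
        to {x} {y} edge =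
          let j , cx , cy = share⇒common (start x) (start y) (m≤m+n _ (len x)) (m≤m+n _ (len y))
                (Share-cong (sym (start≡ x)) (sym (end≡ x)) (sym (start≡ y)) (sym (end≡ y)) (share (inj₂ edge)))
          in j , offset⇐ (start x) (len x) j (len< x) cx , offset⇐ (start y) (len y) j (len< y) cy
        from : ∀ {x y} → x ≢ y → ∃[ j ] (offset k (start x) j ≤ len x × offset k (start y) j ≤ len y) → Edge G x y
        from {x} {y} x≢y (j , cx , cy) = edge-of (unshare {x} {y}
          (Share-cong (start≡ x) (end≡ x) (start≡ y) (end≡ y)
            (common⇒share {j = toℕ j} (Fin.toℕ<n (start x)) (Fin.toℕ<n (start y))
              (offset⇒ (start x) (len x) j cx) (offset⇒ (start y) (len y) j cy)))) x≢y

      edge-covers : ∀ {x j} → ArcEdge caRep x j → CoversEdge (s x) (e x) (toℕ j)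
      edge-covers {x} {j} c = subst₂ (λ a b → CoversEdge a b (toℕ j)) (start≡ x) (end≡ x)
        (offset<⇒ (start x) (len x) j c)

      -- Following a cover once around the cycle closes up to a walk of winding number one.
      module Cover {x₁ : Fin n} (M≤e₁ : M ≤ e x₁) where

        -- Each arc is used at most once, so `suc (j + m)` bounds the length of the closed walk
        -- throughout. On closing, the sum is the level 1 of `x₁`, against `closed-sum`.
        advance : ∀ m {c j t} (xs : List (Fin n)) → length xs ≡ m → Path w x₁ c j t → t ≡ λN c →
                  suc (j + m) ≤ r → (∀ a → e c ≤ a → a < s x₁ → ∃[ z ] (z ∈ xs × s z ≤ a × a < e z)) → ⊥
        advance m {c} {j} xs lm p t≡ le cover with s x₁ ≤? e c
        ... | yes close =
          let d , lev = meet₀ {c} {x₁} (≤-trans (<⇒≤ (s<M c)) M≤e₁) close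
              sum = trans (cong (_⊕ w c x₁) t≡) (trans lev (λN-in (proj₁ (e-right {x₁} M≤e₁))))
          in contradiction (trans (sym sum) (closed-sum (snoc p d) (≤-trans (s≤s (m≤m+n j m)) le))) λ ()
        ... | no ¬close with cover (e c) ≤-refl (≰⇒> ¬close)
        ...   | z , z∈ , sz≤ , lt with delete z∈
        ...     | ys , len≡ , keep with m
        ...       | zero = contradiction (trans (sym lm) len≡) λ ()
        ...       | suc m′ =
          let d , lev = meet₀ {c} {z} (≤-trans (s≤e c) (<⇒≤ lt)) sz≤
          in advance m′ {z} ys (suc-injective (trans (sym len≡) lm)) (snoc p d) (trans (cong (_⊕ w c z) t≡) lev)
               (subst (λ q → suc q ≤ r) (+-suc j m′) le)
               -- An arc that reaches beyond `a`, which is at least `e z`, is not that of `z` and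
               -- survives the deletion.
               (λ a ge a<s → let z′ , z′∈ , b , b′ = cover a (≤-trans (<⇒≤ lt) ge) a<s
                             in z′ , keep z′∈ (λ eq → <⇒≱ (subst (λ q → a < e q) eq b′) ge) , b , b′)

      acyclic : Acyclic r caRep
      acyclic X ∣X∣≤r with Fin.any? (λ j → Fin.all? (λ x → uncovered? x j))
        where
        uncovered? : ∀ x j → Dec (x ∈ₛ X → ¬ ArcEdge caRep x j)
        uncovered? x j with x Subset.∈? X | suc (offset k (start x) j) ≤? len x
        ... | yes x∈ | yes c = no λ f → f x∈ c
        ... | yes _ | no ¬c = yes λ _ → ¬c
        ... | no ¬x∈ | _ = yes λ x∈ → contradiction x∈ ¬x∈
      ... | yes free = free
      ... | no all-covered = ⊥-elim impossible
        where
        covered : ∀ j → ∃[ x ] (x ∈ₛ X × CoversEdge (s x) (e x) (toℕ j))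
        covered j with Fin.any? (λ x → (x Subset.∈? X) ×-dec (suc (offset k (start x) j) ≤? len x))
        ... | yes (x , x∈ , c) = x , x∈ , edge-covers {x} {j} c
        ... | no none = contradiction (j , λ x x∈ c → none (x , x∈ , c)) all-covered

        -- The edge numbered `M - 1` joins the last position to 0; an arc containing it passes the
        -- end of the cycle.
        last : Fin M
        last = fromℕ< {2 + k} ≤-refl

        gate : ∃[ x ] (x ∈ₛ X × M ≤ e x)
        gate with covered last
        ... | x , x∈ , c = x , x∈ , past c
          where
          past : CoversEdge (s x) (e x) (toℕ last) → M ≤ e x
          past (inj₁ (_ , lt)) = subst (λ t → suc t ≤ e x) (Fin.toℕ-fromℕ< {2 + k} ≤-refl) lt
          past (inj₂ lt) = ≤-trans (m≤n+m M (toℕ last)) (<⇒≤ lt)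

        module _ {x₁ : Fin n} (x₁∈ : x₁ ∈ₛ X) (e-max : ∀ x → x ∈ₛ X → e x ≤ e x₁) (M≤e₁ : M ≤ e x₁) where

          -- As `x₁` ends last, no arc of `X` covers the edge `a` by passing the end of the cycle;
          -- so `a` is covered on the first turn, and by an arc other than that of `x₁`, which
          -- starts later.
          cover : ∀ a → e x₁ ≤ a + M → a < s x₁ → ∃[ z ] (z ∈ₛ X × z ≢ x₁ × s z ≤ a × a < e z)
          cover a ge a<s with covered (fromℕ< (<-trans a<s (s<M x₁)))
          ... | z , z∈ , c with subst (CoversEdge (s z) (e z)) (Fin.toℕ-fromℕ< (<-trans a<s (s<M x₁))) c
          ...   | inj₁ (p , q) = z , z∈ , (λ { refl → <⇒≱ a<s p }) , p , q
          ...   | inj₂ q = contradiction (≤-trans (e-max z z∈) ge) (<⇒≱ q)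

          winding : ⊥
          winding =
            -- The position on the cycle at which the arc of `x₁` ends after passing 0.
            let a₀ = e x₁ ∸ M
                a₀+M≡e = m∸n+n≡m M≤e₁
                a₀<s = +-cancelʳ-< M _ _ (subst (_< s x₁ + M) (sym a₀+M≡e) (e<s+M x₁))
                z , z∈ , z≢ , sz≤ , lt = cover a₀ (≤-reflexive (sym a₀+M≡e)) a₀<s
                d , w≡ = meet₁ {z} {x₁} (subst (s z + M ≤_) a₀+M≡e (+-monoˡ-≤ M sz≤))
                ys , len₁ , keep₁ = delete (∈-elements X (x₁∈))
                zs , len₂ , keep₂ = delete (keep₁ (∈-elements X z∈) z≢)
                ∣X∣≡ = trans (sym (length-elements X)) (trans len₁ (cong suc len₂))
            in Cover.advance {x₁} M≤e₁ (length zs) zs refl (snoc nil d) (trans (ℤ.+-identityˡ _) w≡)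
                 -- `x₁` and `z` are already used and joined by a path of length 1, so `X` has
                 -- `2 + length zs` members.
                 (subst (_≤ r) ∣X∣≡ ∣X∣≤r)
                 (λ a ge a<s →
                   let z′ , z′∈ , ne , p , q = cover a
                         (subst (_≤ a + M) a₀+M≡e (+-monoˡ-≤ M (≤-trans (<⇒≤ lt) ge))) a<s
                   in z′ , keep₂ (keep₁ (∈-elements X z′∈) ne) (λ eq → <⇒≱ (subst (λ v → a < e v) eq q) ge) , p , q)

        impossible : ⊥
        impossible =
          let x₁ , x₁∈ , e-max = argmax (Subset._∈? X) e (proj₁ gate , proj₁ (proj₂ gate))
          in winding x₁∈ e-max (≤-trans (proj₂ (proj₂ gate)) (e-max _ (proj₁ (proj₂ gate))))

  module _ (o-max : ∀ x → count (D? x) elems ≤ count N? elems) where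

    acyclicCircularArc : AcyclicCircularArc r G
    acyclicCircularArc with Side.oneSide o-max ρ | Side.oneSide o-max ρ′
      where
      ρ = localRep o
      ρ′ = flip D-refl ρ
    ... | inj₁ T | _ = Circle.caRep o-max ρ T , Circle.acyclic o-max ρ T
      where ρ = localRep o
    ... | inj₂ _ | inj₁ T = Circle.caRep o-max ρ′ T , Circle.acyclic o-max ρ′ T
      where ρ′ = flip D-refl (localRep o)
    ... | inj₂ A | inj₂ B = Circle.caRep o-max ρ T , Circle.acyclic o-max ρ T
      where
      ρ = localRep o
      T = joinEnds o-max ρ A B

locallyInterval⇒circularArc : ∀ n (G : Graph n) r → Connected G → 4 ≤ r →
                              LocallyInterval r G → AcyclicCircularArc r G
locallyInterval⇒circularArc zero G r _ _ _ =
  record { k = 0 ; start = λ () ; len = λ () ; len< = λ () ; repr = λ () } ,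
  λ _ _ → Fin.zero , λ ()
locallyInterval⇒circularArc (suc n) G r conn 4≤r int =
  Wrap.acyclicCircularArc G conn 4≤r int o (λ x → o-max x refl)
  where
  open Graphs G
  open FiniteSearch (finFin (suc n))
  best = argmax {P = λ x → x ≡ x} (λ _ → yes refl) (λ x → count (D? x) elems) (Fin.zero , refl)
  o = proj₁ best
  o-max = λ x → proj₂ (proj₂ best) x

-- Unrolling a circular-arc representation

fromList : ∀ {n} → List (Fin n) → Subset n
fromList [] = ∅
fromList (x ∷ xs) = ⁅ x ⁆ ∪ fromList xs

∣p∪q∣≤∣p∣+∣q∣ : ∀ {n} (p q : Subset n) → ∣ p ∪ q ∣ ≤ ∣ p ∣ + ∣ q ∣
∣p∪q∣≤∣p∣+∣q∣ [] [] = z≤n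
∣p∪q∣≤∣p∣+∣q∣ (true ∷ p) (true ∷ q) =
  s≤s (≤-trans (∣p∪q∣≤∣p∣+∣q∣ p q) (+-monoʳ-≤ ∣ p ∣ (n≤1+n ∣ q ∣)))
∣p∪q∣≤∣p∣+∣q∣ (true ∷ p) (false ∷ q) = s≤s (∣p∪q∣≤∣p∣+∣q∣ p q)
∣p∪q∣≤∣p∣+∣q∣ (false ∷ p) (true ∷ q) =
  ≤-trans (s≤s (∣p∪q∣≤∣p∣+∣q∣ p q)) (≤-reflexive (sym (+-suc ∣ p ∣ ∣ q ∣)))
∣p∪q∣≤∣p∣+∣q∣ (false ∷ p) (false ∷ q) = ∣p∪q∣≤∣p∣+∣q∣ p q

∣fromList∣≤ : ∀ {n} (xs : List (Fin n)) → ∣ fromList xs ∣ ≤ length xs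
∣fromList∣≤ {n} [] = ≤-reflexive (Subset.∣⊥∣≡0 n)
∣fromList∣≤ (x ∷ xs) = ≤-trans (∣p∪q∣≤∣p∣+∣q∣ ⁅ x ⁆ (fromList xs))
  (+-mono-≤ (≤-reflexive (Subset.∣⁅x⁆∣≡1 x)) (∣fromList∣≤ xs))

∈-fromList : ∀ {n} {xs : List (Fin n)} {x} → x ∈ xs → x ∈ₛ fromList xs
∈-fromList {xs = y ∷ xs} (here refl) = Subset.x∈p∪q⁺ (inj₁ (Subset.x∈⁅x⁆ y))
∈-fromList {xs = y ∷ xs} (there i) = Subset.x∈p∪q⁺ (inj₂ (∈-fromList i))

scale-cancel : ∀ {n} a b {i j} → j ≤ n → a * suc n + i ≤ b * suc n + j → a ≤ b
scale-cancel {n} a b {i} {j} j≤n le = ≮⇒≥ λ b<a → <⇒≱ (begin-strict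
  b * suc n + j      <⟨ +-monoʳ-< (b * suc n) (s≤s j≤n) ⟩
  b * suc n + suc n  ≡⟨ +-comm (b * suc n) (suc n) ⟩
  suc b * suc n      ≤⟨ *-monoˡ-≤ (suc n) b<a ⟩
  a * suc n          ≤⟨ m≤m+n _ i ⟩
  a * suc n + i      ∎) le
  where open ≤-Reasoning

scale-mono : ∀ {n} a b {i j} → i ≤ j → a ≤ b → a * suc n + i ≤ b * suc n + j
scale-mono {n} _ _ i≤j a≤b = +-mono-≤ (*-monoˡ-≤ (suc n) a≤b) i≤j

half-< : ∀ {a b r} → a + a < r → r ≤ b + b → a < b
half-< {a} {b} lt le = ≰⇒> λ b≤a → <⇒≱ lt (≤-trans le (+-mono-≤ b≤a b≤a))

both-half-< : ∀ {a b r} → a + a < r → b + b < r → a + b < r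
both-half-< {a} {b} a< b< with ≤-total a b
... | inj₁ le = ≤-<-trans (+-monoˡ-≤ b le) b<
... | inj₂ le = ≤-<-trans (+-monoʳ-≤ a le) a<

both-half-≥ : ∀ {a b r} → r ≤ a + a → r ≤ b + b → r ≤ a + b
both-half-≥ {a} {b} a≥ b≥ with ≤-total a b
... | inj₁ le = ≤-trans a≥ (+-monoʳ-≤ a le)
... | inj₂ le = ≤-trans b≥ (+-monoˡ-≤ b le)

-- Arcs are unrolled to the line by giving each vertex of the ball the level it
-- reaches along a shortest walk; that at most r arcs never close up the cycle
-- makes the levels of any two vertices joined by a ball edge agree.
module Unroll {n : ℕ} (G : Graph n) {r : ℕ} (conn : Connected G) (4≤r : 4 ≤ r)
              (ρ : CARep G) (acyclic : Acyclic r ρ) (v : Fin n) where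
  open Graphs G
  open FiniteSearch (finFin n)
  open CARep ρ using (k; start; len; len<)
  open Offset k

  s e : Fin n → ℕ
  s x = toℕ (start x)
  e x = toℕ (start x) + len x

  s<M : ∀ x → s x < M
  s<M x = Fin.toℕ<n (start x)

  edge⇒≢ : ∀ {x y} → Edge G x y → x ≢ y
  edge⇒≢ {x} xy refl = contradiction (trans (sym xy) (irrefl G x)) λ ()

  edge⇒share : ∀ {x y} → Edge G x y → Share (s x) (e x) (s y) (e y)
  edge⇒share {x} {y} xy =
    let j , cx , cy = Equivalence.to (CARep.repr ρ x y (edge⇒≢ xy)) xy
    in common⇒share {j = toℕ j} (s<M x) (s<M y) (offset⇒ (start x) (len x) j cx) (offset⇒ (start y) (len y) j cy)

  share⇒D : ∀ {x y} → Share (s x) (e x) (s y) (e y) → D x y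
  share⇒D {x} {y} sh with x Fin.≟ y
  ... | yes eq = inj₁ eq
  ... | no x≢y =
    let j , cx , cy = share⇒common (start x) (start y) (m≤m+n _ (len x)) (m≤m+n _ (len y)) sh
    in inj₂ (Equivalence.from (CARep.repr ρ x y x≢y)
         (j , offset⇐ (start x) (len x) j (len< x) cx , offset⇐ (start y) (len y) j (len< y) cy))

  α β : Fin n → ℕ → ℕ
  α x c = s x + c * M
  β x c = e x + c * M

  record Meets (x : Fin n) (c : ℕ) (y : Fin n) (d : ℕ) : Set where
    constructor _,_
    field
      below : α x c ≤ β y d
      above : α y d ≤ β x c

  open Meets

  α≤β : ∀ x c → α x c ≤ β x c
  α≤β x c = +-monoˡ-≤ (c * M) (m≤m+n (s x) (len x))

  -- The level is a successor because the lift of `y` that meets that of `x` may lie one turn lower.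
  share⇒meets : ∀ {x y} c → Share (s x) (e x) (s y) (e y) →
                ∃[ d ] (Meets x (suc c) y d × c ≤ d)
  share⇒meets c (inj₁ (p , q)) = suc c , (+-monoˡ-≤ _ p , +-monoˡ-≤ _ q) , n≤1+n c
  share⇒meets {x} {y} c (inj₂ (inj₁ p)) = c ,
    ( ≤-trans (≤-reflexive (sym (+-assoc (s x) M (c * M)))) (+-monoˡ-≤ (c * M) p)
    , ≤-trans (+-monoˡ-≤ (c * M) (<⇒≤ (s<M y))) (m≤n+m (suc c * M) (e x))) , ≤-refl
  share⇒meets {x} {y} c (inj₂ (inj₂ p)) = suc (suc c) ,
    ( ≤-trans (+-monoˡ-≤ (suc c * M) (<⇒≤ (s<M x))) (m≤n+m (suc (suc c) * M) (e y))
    , ≤-trans (≤-reflexive (sym (+-assoc (s y) M (suc c * M)))) (+-monoˡ-≤ (suc c * M) p)) ,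
    ≤-trans (n≤1+n c) (n≤1+n (suc c))

  higher : ∀ {x y} c t → α y (suc (t + c)) ≤ β x c → s y + M ≤ e x
  higher {x} {y} c t le = ≤-trans (m≤m+n (s y + M) (t * M)) (+-cancelʳ-≤ (c * M) _ _
    (subst (_≤ β x c) (expand (s y) M t c) le))
    where
    expand : ∀ a m t c → a + suc (t + c) * m ≡ (a + m + t * m) + c * m
    expand = ℕ-Solver.solve-∀

  meets⇒D : ∀ {x c y d} → Meets x c y d → D x y
  meets⇒D {x} {c} {y} {d} (p , q) with ≤-total c d
  ... | inj₁ c≤d = shift (d ∸ c) (m∸n+n≡m c≤d)
    where
    shift : ∀ t → t + c ≡ d → D x y
    shift zero refl = share⇒D (inj₁ (+-cancelʳ-≤ (c * M) _ _ p , +-cancelʳ-≤ (c * M) _ _ q))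
    shift (suc t) refl = share⇒D (inj₂ (inj₂ (higher {x} {y} c t q)))
  ... | inj₂ d≤c = shift (c ∸ d) (m∸n+n≡m d≤c)
    where
    shift : ∀ t → t + d ≡ c → D x y
    shift zero refl = share⇒D (inj₁ (+-cancelʳ-≤ (d * M) _ _ p , +-cancelʳ-≤ (d * M) _ _ q))
    shift (suc t) refl = share⇒D (inj₂ (inj₁ (higher {y} {x} d t p)))

  data Lift (x : Fin n) (c : ℕ) : Fin n → ℕ → ℕ → Set where
    nil  : Lift x c x c 0
    cons : ∀ {y d z f k} → Edge G x y → Meets x c y d → Lift y d z f k → Lift x c z f (suc k)

  -- A step lowers the level by at most one, so a start above the length of the walk keeps all
  -- levels positive.
  lift : ∀ {x y k c} → Walk G x y k → k < c → ∃[ d ] (Lift x c y d k × 0 < d)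
  lift {c = c} here lt = c , nil , lt
  lift {c = suc c} (step xy p) (s≤s lt) =
    let d , m , c≤d = share⇒meets c (edge⇒share xy)
        f , q , pos = lift p (<-≤-trans lt c≤d)
    in f , cons xy m q , pos

  later : ∀ {x c y d k} → Lift x c y d k → List (Fin n)
  later nil = []
  later (cons {y = y} _ _ q) = y ∷ later q

  length-later : ∀ {x c y d k} (q : Lift x c y d k) → length (later q) ≡ k
  length-later nil = refl
  length-later (cons _ _ q) = cong suc (length-later q)

  module Cut (j : Fin M) where

    Free : Fin n → Set
    Free x = ¬ ArcEdge ρ x j

    -- The lifts of the missed edge `j` cut the line into windows of length `M`. A free arc at level
    -- `c` lies in window number `c - wrap x`; the equations below compare these numbers with the
    -- subtractions moved to the other side.
    wrap : Fin n → ℕ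
    wrap x with s x ≤? toℕ j
    ... | yes _ = 1
    ... | no _ = 0

    window : ∀ {x} → Free x → toℕ j < s x + wrap x * M × e x + wrap x * M ≤ toℕ j + M
    window {x} free with s x ≤? toℕ j
    ... | yes s≤j =
      subst (toℕ j <_) (cong (s x +_) (sym (*-identityˡ M))) (<-≤-trans (Fin.toℕ<n j) (m≤n+m M (s x))) ,
      +-mono-≤ (≮⇒≥ λ lt → free (offset<⇐ (start x) (len x) j (len< x) (inj₁ (s≤j , lt)))) (≤-reflexive (*-identityˡ M))
    ... | no s≰j =
      subst (toℕ j <_) (sym (+-identityʳ (s x))) (≰⇒> s≰j) ,
      subst (_≤ toℕ j + M) (sym (+-identityʳ (e x)))
        (≮⇒≥ λ lt → free (offset<⇐ (start x) (len x) j (len< x) (inj₂ lt)))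

    level-≤ : ∀ {x c y d} → Free x → Free y → α x c ≤ β y d → c + wrap y ≤ d + wrap x
    level-≤ {x} {c} {y} {d} fx fy le = ≤-pred (*-cancelʳ-< M _ _ (+-cancelˡ-< (toℕ j) _ _ (begin-strict
      toℕ j + (c + wrap y) * M                     <⟨ +-monoˡ-< _ (proj₁ (window fx)) ⟩
      s x + wrap x * M + (c + wrap y) * M          ≡⟨ shuffle (s x) (wrap x) c (wrap y) M ⟩
      α x c + (wrap x + wrap y) * M                ≤⟨ +-monoˡ-≤ _ le ⟩
      β y d + (wrap x + wrap y) * M                ≡⟨ shuffle′ (e y) (wrap x) d (wrap y) M ⟩
      e y + wrap y * M + (d + wrap x) * M          ≤⟨ +-monoˡ-≤ _ (proj₂ (window fy)) ⟩
      toℕ j + M + (d + wrap x) * M                 ≡⟨ +-assoc (toℕ j) M _ ⟩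
      toℕ j + suc (d + wrap x) * M                 ∎)))
      where
      open ≤-Reasoning
      shuffle : ∀ a u c v m → a + u * m + (c + v) * m ≡ a + c * m + (u + v) * m
      shuffle = ℕ-Solver.solve-∀
      shuffle′ : ∀ a u d v m → a + d * m + (u + v) * m ≡ a + v * m + (d + u) * m
      shuffle′ = ℕ-Solver.solve-∀

    level-≡ : ∀ {x c y d} → Free x → Free y → Meets x c y d → c + wrap y ≡ d + wrap x
    level-≡ {x} {c} {y} {d} fx fy (p , q) =
      ≤-antisym (level-≤ {x} {c} {y} {d} fx fy p) (level-≤ {y} {d} {x} {c} fy fx q)

    lift-level : ∀ {x c y d k} (q : Lift x c y d k) → Free x → (∀ {z} → z ∈ later q → Free z) →
                 c + wrap y ≡ d + wrap x
    lift-level nil fx _ = refl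
    lift-level {x} {c} {z} {f} (cons {y = y} {d = d} _ m q) fx fs = +-cancelʳ-≡ (wrap y) _ _ (begin
      c + wrap z + wrap y    ≡⟨ exchange c (wrap z) (wrap y) ⟩
      c + wrap y + wrap z    ≡⟨ cong (_+ wrap z) (level-≡ fx (fs (here refl)) m) ⟩
      d + wrap x + wrap z    ≡⟨ exchange d (wrap x) (wrap z) ⟩
      d + wrap z + wrap x    ≡⟨ cong (_+ wrap x) (lift-level q (fs (here refl)) (λ i → fs (there i))) ⟩
      f + wrap y + wrap x    ≡⟨ exchange f (wrap y) (wrap x) ⟩
      f + wrap x + wrap y    ∎)
      where
      open ≡-Reasoning
      exchange : ∀ a b c → a + b + c ≡ a + c + b
      exchange = ℕ-Solver.solve-∀

    lift-target : ∀ {x c y d k} (q : Lift x c y d k) → (∀ {z} → z ∈ later q → Free z) → Free x → Free y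
    lift-target nil fs fx = fx
    lift-target (cons _ _ q) fs fx = lift-target q (λ i → fs (there i)) (fs (here refl))

  module Layout (dst : Fin n → ℕ) (Dst : ∀ x → Dist G v x (dst x)) (c₀ : ℕ) (level : Fin n → ℕ)
                (lifted : ∀ x → Lift v c₀ x (level x) (dst x)) (0<level : ∀ x → 0 < level x) where

    -- The arcs on the two walks from `v` number at most `1 + dst x + dst y`, so some edge of the
    -- cycle is missed by all of them. Cut there, all their lifts lie in the window of `v`, and so
    -- does the lift of `y` that meets that of `x`; within one window the level of `y` is
    -- determined.
    edge⇒meets : ∀ {x y} → Edge G x y → suc (dst x + dst y) ≤ r → Meets x (level x) y (level y)
    edge⇒meets {x} {y} xy le =
      let d , m = neighbour (0<level x) in subst (Meets x (level x) y) (d≡ m) m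
      where
      neighbour : ∀ {c} → 0 < c → ∃[ d ] Meets x c y d
      neighbour {suc c} _ = let d , m , _ = share⇒meets c (edge⇒share xy) in d , m
      Lx = lifted x
      Ly = lifted y
      xs = v ∷ later Lx ++ later Ly
      small : length xs ≤ r
      small = subst (_≤ r) (cong suc (sym (trans (length-++ (later Lx))
                (cong₂ _+_ (length-later Lx) (length-later Ly))))) le
      cut = acyclic (fromList xs) (≤-trans (∣fromList∣≤ xs) small)
      open Cut (proj₁ cut)
      free : ∀ {z} → z ∈ xs → Free z
      free i = proj₂ cut _ (∈-fromList i)
      onX : ∀ {z} → z ∈ later Lx → Free z
      onX i = free (there (∈-++⁺ˡ i))
      onY : ∀ {z} → z ∈ later Ly → Free z
      onY i = free (there (∈-++⁺ʳ (later Lx) i))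
      d≡ : ∀ {d} → Meets x (level x) y d → d ≡ level y
      d≡ {d} m = +-cancelʳ-≡ (wrap x + wrap v) _ _ (begin
        d + (wrap x + wrap v)       ≡⟨ sym (+-assoc d _ _) ⟩
        d + wrap x + wrap v         ≡⟨ cong (_+ wrap v) (sym (level-≡ {x} {level x} {y} {d}
                                         (lift-target Lx onX (free (here refl))) (lift-target Ly onY (free (here refl))) m)) ⟩
        level x + wrap y + wrap v   ≡⟨ exchange (level x) (wrap y) (wrap v) ⟩
        level x + wrap v + wrap y   ≡⟨ cong (_+ wrap y) (sym (lift-level Lx (free (here refl)) onX)) ⟩
        c₀ + wrap x + wrap y        ≡⟨ exchange c₀ (wrap x) (wrap y) ⟩
        c₀ + wrap y + wrap x        ≡⟨ cong (_+ wrap x) (lift-level Ly (free (here refl)) onY) ⟩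
        level y + wrap v + wrap x   ≡⟨ exchange′ (level y) (wrap v) (wrap x) ⟩
        level y + (wrap x + wrap v) ∎)
        where
        open ≡-Reasoning
        exchange : ∀ a b c → a + b + c ≡ a + c + b
        exchange = ℕ-Solver.solve-∀
        exchange′ : ∀ a b c → a + b + c ≡ a + (c + b)
        exchange′ = ℕ-Solver.solve-∀

    dist-step : ∀ {z x j} → Walk G v z j → D z x → dst x ≤ suc j
    dist-step {x = x} p (inj₁ refl) = m≤n⇒m≤1+n (proj₂ (Dst x) _ p)
    dist-step {x = x} p (inj₂ e) = proj₂ (Dst x) _ (walk-snoc p e)

    -- Consecutive lifts overlap, so they cover everything in between. The last one starts beyond
    -- `a`, hence the vertex found comes strictly earlier on the walk.
    passes-right : ∀ {a y d u f k} → Lift y d u f k → β y d < a → a < α u f →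
                   ∃[ z ] ∃[ g ] ∃[ j ] (Walk G y z j × j < k × α z g ≤ a × a ≤ β z g)
    passes-right {y = y} {d} nil b< <a = contradiction (≤-<-trans (α≤β y d) (<-trans b< <a)) (<-irrefl refl)
    passes-right {a} (cons {y = z} {d = g} yz m q) b< <a with β z g <? a
    ... | yes z< = let t , h , j , p , j< , c = passes-right q z< <a in t , h , suc j , step yz p , s≤s j< , c
    ... | no z≥ with q
    ...   | nil = contradiction (<-≤-trans <a (above m)) (<-asym b<)
    ...   | cons _ _ _ = z , g , 1 , step yz here , s≤s (s≤s z≤n) ,
              ≤-trans (above m) (<⇒≤ b<) , ≮⇒≥ z≥

    passes-left : ∀ {a y d u f k} → Lift y d u f k → a < α y d → β u f < a →
                  ∃[ z ] ∃[ g ] ∃[ j ] (Walk G y z j × j < k × α z g ≤ a × a ≤ β z g)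
    passes-left {y = y} {d} nil <a b< = contradiction (≤-<-trans (α≤β y d) (<-trans b< <a)) (<-irrefl refl)
    passes-left {a} (cons {y = z} {d = g} yz m q) <a b< with a <? α z g
    ... | yes z> = let t , h , j , p , j< , c = passes-left q z> b< in t , h , suc j , step yz p , s≤s j< , c
    ... | no z≤ with q
    ...   | nil = contradiction (<-≤-trans <a (below m)) (<-asym b<)
    ...   | cons _ _ _ = z , g , 1 , step yz here , s≤s (s≤s z≤n) ,
              ≮⇒≥ z≤ , ≤-trans (<⇒≤ <a) (below m)

    Far : Fin n → Set
    Far x = r ≤ dst x + dst x

    Far? : ∀ x → Dec (Far x)
    Far? x = r ≤? dst x + dst x

    lower upper : Fin n → ℕ
    lower x = α x (level x)
    upper x = β x (level x)

    far-apart : ∀ {x} → Far x → β v c₀ < lower x ⊎ upper x < α v c₀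
    far-apart {x} far with α v c₀ ≤? upper x | lower x ≤? β v c₀
    ... | no p | _ = inj₂ (≰⇒> p)
    ... | yes _ | no q = inj₁ (≰⇒> q)
    ... | yes p | yes q = contradiction (≤-trans 4≤r far)
      (<⇒≱ (s≤s (≤-trans (+-mono-≤ d≤1 d≤1) (n≤1+n 2))))
      where
      d≤1 : dst x ≤ 1
      d≤1 = dist-step here (meets⇒D {v} {c₀} {x} {level x} (p , q))

    -- The ball has no edges between vertices at distance exactly r/2, so those
    -- vertices are shrunk to the end of their arc that faces v.
    tip : Fin n → ℕ
    tip x with β v c₀ <? lower x
    ... | yes _ = lower x
    ... | no _ = upper x

    tip-in : ∀ x → lower x ≤ tip x × tip x ≤ upper x
    tip-in x with β v c₀ <? lower x
    ... | yes _ = ≤-refl , α≤β x (level x)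
    ... | no _ = α≤β x (level x) , ≤-refl

    -- If `u` met `x` only beyond its tip, the walk from `v` to `u` would pass over the tip at an
    -- earlier vertex `z`. Being adjacent to `x`, this `z` would give `dst x` at most `dst u`.
    tip-met : ∀ {u x} → dst u < dst x → Far x → Meets u (level u) x (level x) →
              lower u ≤ tip x × tip x ≤ upper u
    tip-met {u} {x} nearer far (p , q) with β v c₀ <? lower x
    ... | yes right = ≮⇒≥ (λ lt →
        let z , g , j , walk , j< , a , b = passes-right (lifted u) right lt
        in <⇒≱ nearer (≤-trans (dist-step walk (meets⇒D {z} {g} {x} {level x}
             (≤-trans a (α≤β x (level x)) , b))) j<)) , q
    ... | no ¬right = p , ≮⇒≥ (λ lt →
        let z , g , j , walk , j< , a , b = passes-left (lifted u) on-left lt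
        in <⇒≱ nearer (≤-trans (dist-step walk (meets⇒D {z} {g} {x} {level x}
             (a , ≤-trans (α≤β x (level x)) b))) j<))
        where
        on-left : upper x < α v c₀
        on-left = [ (λ right → contradiction right ¬right) , (λ l → l) ]′ (far-apart far)

    -- Each point of the line is split into `suc n` places. A far vertex takes the single place
    -- `toℕ x` of its tip, so that far vertices with equal tips stay disjoint; the others take all
    -- places of their points.
    newLo newHi : Fin n → ℕ
    newLo x with Far? x
    ... | yes _ = tip x * suc n + toℕ x
    ... | no _ = lower x * suc n + 0
    newHi x with Far? x
    ... | yes _ = tip x * suc n + toℕ x
    ... | no _ = upper x * suc n + n

    newLo-far : ∀ {x} → Far x → newLo x ≡ tip x * suc n + toℕ x
    newLo-far {x} f with Far? x
    ... | yes _ = refl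
    ... | no ¬f = contradiction f ¬f

    newHi-far : ∀ {x} → Far x → newHi x ≡ tip x * suc n + toℕ x
    newHi-far {x} f with Far? x
    ... | yes _ = refl
    ... | no ¬f = contradiction f ¬f

    newLo-near : ∀ {x} → ¬ Far x → newLo x ≡ lower x * suc n + 0
    newLo-near {x} ¬f with Far? x
    ... | yes f = contradiction f ¬f
    ... | no _ = refl

    newHi-near : ∀ {x} → ¬ Far x → newHi x ≡ upper x * suc n + n
    newHi-near {x} ¬f with Far? x
    ... | yes f = contradiction f ¬f
    ... | no _ = refl

    toℕ≤n : ∀ (x : Fin n) → toℕ x ≤ n
    toℕ≤n x = <⇒≤ (Fin.toℕ<n x)

    newLo≤newHi : ∀ x → newLo x ≤ newHi x
    newLo≤newHi x with Far? x
    ... | yes _ = ≤-refl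
    ... | no _ = scale-mono (lower x) (upper x) z≤n (α≤β x (level x))

    hi-arg : ∃[ x ] (⊤ × (∀ y → ⊤ → newHi y ≤ newHi x))
    hi-arg = argmax (λ _ → yes tt) newHi (v , tt)

    -- Being far and in the ball forces `dst x + dst x` to equal `r`.
    far-near : ∀ {u x} → BallVertex G v r x → ¬ Far u → Far x → dst u + dst x < r × dst u < dst x
    far-near {u} {x} (a , Da , a≤) ¬fu fx = ≤-trans (+-monoˡ-< (dst x) lt) 2d≤r , lt
      where
      lt : dst u < dst x
      lt = half-< (≰⇒> ¬fu) fx
      d≤ : dst x ≤ r / 2
      d≤ = subst (_≤ r / 2) (Dist-unique Da (Dst x)) a≤
      2d≤r : dst x + dst x ≤ r
      2d≤r = ≤-trans (+-mono-≤ d≤ d≤) (subst (_≤ r)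
        (trans (*-comm (r / 2) 2) (cong (r / 2 +_) (+-identityʳ (r / 2)))) (m/n*n≤m r 2))

    ballEdge⇒ : ∀ {x y} → BallEdge G v r x y → Edge G x y × dst x + dst y < r
    ballEdge⇒ {x} {y} (e , a , b , Da , Db , lt) =
      e , subst₂ (λ a b → a + b < r) (Dist-unique Da (Dst x)) (Dist-unique Db (Dst y)) lt

    ⇒ballEdge : ∀ {x y} → x ≢ y → D x y → dst x + dst y < r → BallEdge G v r x y
    ⇒ballEdge x≢y (inj₁ eq) _ = contradiction eq x≢y
    ⇒ballEdge {x} {y} _ (inj₂ e) lt = e , dst x , dst y , Dst x , Dst y , lt

    Overlap : Fin n → Fin n → Set
    Overlap x y = newLo x ≤ newHi y × newLo y ≤ newHi x

    forth : ∀ {x y} → BallVertex G v r x → BallVertex G v r y → BallEdge G v r x y → Overlap x y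
    forth {x} {y} Vx Vy be = cases (Far? x) (Far? y)
      where
      lt : dst x + dst y < r
      lt = proj₂ (ballEdge⇒ be)
      m : Meets x (level x) y (level y)
      m = edge⇒meets (proj₁ (ballEdge⇒ be)) lt
      near-far : ∀ {x y} → BallVertex G v r y → ¬ Far x → Far y → Meets x (level x) y (level y) → Overlap x y
      near-far {x} {y} Vy ¬fx fy m =
        let a , b = tip-met {x} {y} (proj₂ (far-near {x} {y} Vy ¬fx fy)) fy m in
        subst₂ _≤_ (sym (newLo-near ¬fx)) (sym (newHi-far fy)) (scale-mono (lower x) (tip y) z≤n a) ,
        subst₂ _≤_ (sym (newLo-far fy)) (sym (newHi-near ¬fx)) (scale-mono (tip y) (upper x) (toℕ≤n y) b)
      cases : Dec (Far x) → Dec (Far y) → Overlap x y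
      cases (yes fx) (yes fy) = contradiction (both-half-≥ {dst x} fx fy) (<⇒≱ lt)
      cases (no ¬fx) (no ¬fy) =
        subst₂ _≤_ (sym (newLo-near ¬fx)) (sym (newHi-near ¬fy)) (scale-mono (lower x) (upper y) z≤n (below m)) ,
        subst₂ _≤_ (sym (newLo-near ¬fy)) (sym (newHi-near ¬fx)) (scale-mono (lower y) (upper x) z≤n (above m))
      cases (no ¬fx) (yes fy) = near-far Vy ¬fx fy m
      cases (yes fx) (no ¬fy) = swap (near-far Vx ¬fy fx (above m , below m))

    back : ∀ {x y} → x ≢ y → BallVertex G v r x → BallVertex G v r y → Overlap x y → BallEdge G v r x y
    back {x} {y} x≢y Vx Vy o@(p , q) = cases (Far? x) (Far? y)
      where
      near-far : ∀ {x y} → ¬ Far x → Far y → Overlap x y → D x y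
      near-far {x} {y} ¬fx fy (p , q) = meets⇒D {x} {level x} {y} {level y}
        ( ≤-trans (scale-cancel (lower x) (tip y) (toℕ≤n y) (subst₂ _≤_ (newLo-near ¬fx) (newHi-far fy) p))
                  (proj₂ (tip-in y))
        , ≤-trans (proj₁ (tip-in y))
                  (scale-cancel (tip y) (upper x) ≤-refl (subst₂ _≤_ (newLo-far fy) (newHi-near ¬fx) q)))
      far-far : ∀ {x y} → Far x → Far y → newLo x ≤ newHi y → newLo y ≤ newHi x → toℕ x ≤ toℕ y
      far-far {x} {y} fx fy p q = +-cancelˡ-≤ (tip x * suc n) _ _
        (subst (λ t → tip x * suc n + toℕ x ≤ t * suc n + toℕ y) (sym t≡) p′)
        where
        p′ : tip x * suc n + toℕ x ≤ tip y * suc n + toℕ y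
        p′ = subst₂ _≤_ (newLo-far fx) (newHi-far fy) p
        t≡ : tip x ≡ tip y
        t≡ = ≤-antisym (scale-cancel (tip x) (tip y) (toℕ≤n y) p′)
               (scale-cancel (tip y) (tip x) (toℕ≤n x) (subst₂ _≤_ (newLo-far fy) (newHi-far fx) q))
      cases : Dec (Far x) → Dec (Far y) → BallEdge G v r x y
      cases (yes fx) (yes fy) =
        contradiction (Fin.toℕ-injective (≤-antisym (far-far fx fy p q) (far-far fy fx q p))) x≢y
      cases (no ¬fx) (no ¬fy) = ⇒ballEdge x≢y
        (meets⇒D {x} {level x} {y} {level y}
          ( scale-cancel (lower x) (upper y) ≤-refl (subst₂ _≤_ (newLo-near ¬fx) (newHi-near ¬fy) p)
          , scale-cancel (lower y) (upper x) ≤-refl (subst₂ _≤_ (newLo-near ¬fy) (newHi-near ¬fx) q)))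
        (both-half-< {dst x} (≰⇒> ¬fx) (≰⇒> ¬fy))
      cases (no ¬fx) (yes fy) = ⇒ballEdge x≢y (near-far ¬fx fy o) (proj₁ (far-near {x} {y} Vy ¬fx fy))
      cases (yes fx) (no ¬fy) = ⇒ballEdge x≢y (D-sym (near-far ¬fy fx (swap o)))
        (subst (_< r) (+-comm (dst y) (dst x)) (proj₁ (far-near {y} {x} Vx ¬fy fx)))

    interval : IsInterval (BallVertex G v r) (BallEdge G v r)
    interval = record
      { m = suc (newHi (proj₁ hi-arg))
      ; lo = newLo
      ; hi = newHi
      ; valid = λ x _ → newLo≤newHi x , s≤s (proj₂ (proj₂ hi-arg) x tt)
      ; repr = λ x y Vx Vy x≢y → mk⇔ (forth Vx Vy) (back x≢y Vx Vy)
      }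

  dst : Fin n → ℕ
  dst x = proj₁ (dist (proj₂ (conn v x)))

  Dst : ∀ x → Dist G v x (dst x)
  Dst x = proj₁ (proj₂ (dist (proj₂ (conn v x))))

  c₀-arg : ∃[ x ] (⊤ × (∀ y → ⊤ → dst y ≤ dst x))
  c₀-arg = argmax (λ _ → yes tt) dst (v , tt)

  c₀ : ℕ
  -- Above every distance from `v`, as `lift` requires.
  c₀ = suc (dst (proj₁ c₀-arg))

  lifted : ∀ x → ∃[ d ] (Lift v c₀ x d (dst x) × 0 < d)
  lifted x = lift (proj₁ (Dst x)) (s≤s (proj₂ (proj₂ c₀-arg) x tt))

  interval : IsInterval (BallVertex G v r) (BallEdge G v r)
  interval = Layout.interval dst Dst c₀ (λ x → proj₁ (lifted x))
    (λ x → proj₁ (proj₂ (lifted x))) (λ x → proj₂ (proj₂ (lifted x)))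

theorem1 : ∀ (n : ℕ) (G : Graph n) (r : ℕ) → Connected G → 4 ≤ r →
    (LocallyInterval r G ⇔ AcyclicCircularArc r G)
theorem1 n G r conn 4≤r = mk⇔
  (locallyInterval⇒circularArc n G r conn 4≤r)
  (λ (ρ , acyclic) v → Unroll.interval G conn 4≤r ρ acyclic v)
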